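{- Let $M$ be a matroid on a finite set $E$ with circuits $\mathfrak C$ and cocircuits $\mathfrak C^*$, and let $\mathbb H$ be a hyperfield with an involution $\tau$. For a homomorphism $\Phi$ into $\mathbb H^*$ defined on one of the groups $\mathbb T_M^{(0)}\subseteq\mathbb T_M\subseteq\mathbb T_M^{\mathfrak C,\mathfrak C^*}$ consider the condition ($\mathcal S$) for any $C\in\mathfrak C$ and $D\in\mathfrak C^*$ with $C\cap D=\{x_0,x_1,\dots,x_k\}$, $k\ge2$ (the $x_i$ distinct), and any circuits $C_j\in\mathfrak C$ with $C_j\cap D=\{x_0,x_j\}$, $1\le j\le k$, $$1\in\boxplus_{j=1}^{k}\Phi\left(\frac{C(x_j)\,C_j(x_0)}{C(x_0)\,C_j(x_j)}\right).$$ (1) Any pair $(\gamma,\delta)$ of $\mathbb H^*$-circuit and $\mathbb H^*$-cocircuit signatures of $M$ that are strong orthogonal with respect to $\tau$ defines a homomorphism $\Phi:\mathbb T_M^{\mathfrak C,\mathfrak C^*}\to\mathbb H^*$ that satisfies ($\mathcal S$), by setting $\Phi(C(x))=\gamma C(x)$ for all $C\in\mathfrak C$, $x\in C$, and $\Phi(D(y))=\tau(\delta D(y))$ for all $D\in\mathfrak C^*$, $y\in D$. (2) Conversely, any homomorphism $\Phi:\mathbb T_M^{\mathfrak C,\mathfrak C^*}\to\mathbb H^*$ that satisfies ($\mathcal S$) defines a pair $(\gamma,\delta)$ of $\mathbb H^*$-circuit and $\mathbb H^*$-cocircuit signatures of $M$ that are strong orthogonal with respect to $\tau$, by setting $\gamma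 C(x)=\Phi(C(x))$ for all $C\in\mathfrak C$, $x\in C$, and $\delta D(y)=\tau(\Phi(D(y)))$ for all $D\in\mathfrak C^*$, $y\in D$. (3) Two such homomorphisms define the same strong $\mathbb H$-matroid with underlying matroid $M$ if and only if they coincide on the Tutte group $\mathbb T_M$, while they define the same strong rescaling class of $M$ if and only if they coincide on the inner Tutte group $\mathbb T_M^{(0)}$. (4) In particular, there exist one-to-one correspondences between: $\mathcal N^{\tau,s}_{\mathbb H}(M)$ and the homomorphisms $\mathbb T_M^{\mathfrak C,\mathfrak C^*}\to\mathbb H^*$ that satisfy ($\mathcal S$); $\mathcal M^{s}_{\mathbb H}(M)$ and the homomorphisms $\mathbb T_M\to\mathbb H^*$ that satisfy ($\mathcal S$); $\mathcal R^{s}_{\mathbb H}(M)$ and the homomorphisms $\mathbb T_M^{(0)}\to\mathbb H^*$ that satisfy ($\mathcal S$). (5) The same results (1)–(4) hold in the weak case, i.e. with "strong" replaced by "weak", superscripts $s$ by $w$, and ($\mathcal S$) replaced by the condition ($\mathcal W$), which is the same statement as ($\mathcal S$) but with the condition $k\le2$ (so that it is required only for $k=2$).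
   Context: A hyperfield is $(\mathbb H,\boxplus,\odot,0,1)$ with $0\ne1$ where: $\boxplus$ is a commutative, associative hyperoperation (each $a\boxplus b$ is a nonempty subset of $\mathbb H$; for subsets, $A\boxplus B=\bigcup_{a\in A,b\in B}a\boxplus b$) with $0\boxplus x=\{x\}$, each $x$ has a unique $-x$ with $0\in x\boxplus -x$, and $x\in y\boxplus z\iff z\in x\boxplus -y$; $(\mathbb H,\odot,1)$ is a commutative monoid, $0\odot x=0$, $a\odot(x\boxplus y)=(a\odot x)\boxplus(a\odot y)$; and $\mathbb H^*=\mathbb H\setminus\{0\}$ is a group under $\odot$. An involution is a map $\tau:\mathbb H\to\mathbb H$ with $\tau(0)=0$, $\tau(1)=1$, $\tau(x\odot y)=\tau(x)\odot\tau(y)$, $\tau(x\boxplus y)\subseteq\tau(x)\boxplus\tau(y)$ and $\tau\circ\tau=\mathrm{id}$. Tutte groups. $\mathbb T_M^{\mathfrak C,\mathfrak C^*}$ is the multiplicative abelian group with generators $\epsilon_M$, $C(x)$ ($C\in\mathfrak C$, $x\in C$), $D(y)$ ($D\in\mathfrak C^*$, $y\in D$) and relations $\epsilon_M^2=1$ and $C(x)D(x)=\epsilon_MC(y)D(y)$ whenever $C\in\mathfrak C$, $D\in\mathfrak C^*$, $C\cap D=\{x,y\}$ with $x\neq y$. The Tutte group $\mathbb T_M$ is the subgroup generated by $\epsilon_M$, all $C(x)C(y)^{ -1}$ ($x,y\in C\in\mathfrak C$) and all $D(x)D(y)^{ -1}$ ($x,y\in D\in\mathfrak C^*$). The inner Tutte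 group $\mathbb T_M^{(0)}$ is the kernel of the homomorphism $\mathbb T_M^{\mathfrak C,\mathfrak C^*}\to\mathbb Z^E\times\mathbb Z^{\mathfrak C}\times\mathbb Z^{\mathfrak C^*}$ given by $\epsilon_M\mapsto0$, $C(x)\mapsto(\mathbf 1_x,\mathbf 1_C,0)$, $D(y)\mapsto(-\mathbf 1_y,0,\mathbf 1_D)$; one has $\mathbb T_M^{(0)}\subseteq\mathbb T_M$. Signatures. An $\mathbb H^*$-circuit signature is a family $\gamma=\{\gamma C:C\to\mathbb H^*\}_{C\in\mathfrak C}$; an $\mathbb H^*$-cocircuit signature is a family $\delta=\{\delta D:D\to\mathbb H^*\}_{D\in\mathfrak C^*}$. They are strong orthogonal with respect to $\tau$ if $0\in\boxplus_{x\in C\cap D}\gamma C(x)\odot\tau(\delta D(x))$ for all $C\in\mathfrak C$, $D\in\mathfrak C^*$ (empty sum $=0$), and weak orthogonal if this holds whenever $|C\cap D|\le3$. $\mathcal N^{\tau,s}_{\mathbb H}(M)$ (resp. $\mathcal N^{\tau,w}_{\mathbb H}(M)$) is the set of strong (resp. weak) orthogonal pairs. $(\gamma_1,\delta_1)\sim_\tau(\gamma_2,\delta_2)$ if there are $b_C,l_D\in\mathbb H^*$ with $\gamma_1C(x)=b_C\odot\gamma_2C(x)$, $\delta_1D(y)=l_D\odot\delta_2D(y)$ for all $C\in\mathfrak C$, $x\in C$, $D\in\mathfrak C^*$, $y\in D$. A strong (weak) $\mathbb H$-matroid with underlying matroid $M$ is a $\sim_\tau$-class in $\mathcal N^{\tau,s}_{\mathbb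 H}(M)$ ($\mathcal N^{\tau,w}_{\mathbb H}(M)$); the set of these is $\mathcal M^s_{\mathbb H}(M)$ ($\mathcal M^w_{\mathbb H}(M)$). $(\gamma_1,\delta_1)\approx_\tau(\gamma_2,\delta_2)$ if there is $h:E\to\mathbb H^*$ with $\gamma_1C(x)=h(x)\odot\gamma_2C(x)$ and $\delta_1D(y)=\tau(h(y)^{ -1})\odot\delta_2D(y)$ for all $C$, $x\in C$, $D$, $y\in D$. Two $\sim_\tau$-classes are $\cong_\tau$-equivalent if they have $\approx_\tau$-equivalent representatives. A strong (weak) rescaling class is a $\cong_\tau$-class; the set of these is $\mathcal R^s_{\mathbb H}(M)$ ($\mathcal R^w_{\mathbb H}(M)$).
   Formalization: Homomorphisms from the three Tutte groups are additionally required to send ε_M to −1 (otherwise (2) fails, e.g. for U_{1,2} over the reals with the trivial homomorphism); independence in the matroid is assumed decidable, which is automatic classically. -}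

module Defs where

open import Level using (Level; 0ℓ; suc; _⊔_)
open import Algebra.Bundles using (AbelianGroup; CommutativeSemigroup; RawGroup)
open import Algebra.Core using (Op₁; Op₂)
open import Algebra.Morphism.Bundles using (GroupHomomorphism)
open import Algebra.Morphism.Structures using (IsGroupHomomorphism; IsGroupMonomorphism)
open import Algebra.Structures using (IsCommutativeMonoid; IsAbelianGroup)
import Algebra.Construct.DirectProduct as DirectProduct
import Algebra.Construct.Pointwise as Pointwise
import Algebra.Morphism.GroupMonomorphism as GroupMonomorphism
import Algebra.Properties.AbelianGroup as AbelianGroupProperties
import Algebra.Properties.CommutativeSemigroup as CommutativeSemigroupProperties
import Data.Bool as Bool
open import Data.Fin as Fin using (Fin)
open import Data.Fin.Subset using (Subset; inside; outside; _∈_; _∉_; _⊆_; _⊂_; _∩_; _∪_; ⁅_⁆; ∁; ∣_∣)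
  renaming (⊥ to ∅)
open import Data.Fin.Subset.Properties using (p∩q⊆p; p∩q⊆q; x∈p∩q⁺; x∈p∪q⁺; x∈⁅x⁆)
open import Data.Integer as ℤ using (ℤ; 0ℤ; 1ℤ)
import Data.Integer.Properties as ℤ
open import Data.List using (List; []; _∷_; map; tabulate)
open import Data.Nat as ℕ using (ℕ; _≤_; _<_)
open import Data.Product using (∃; ∃₂; _×_; _,_; proj₁; proj₂)
open import Data.Refinement using (Refinement; Refinement-syntax; value; _,_)
import Data.Irrelevant as Irrelevant
open import Data.Sum using (inj₁; inj₂)
open import Data.Vec using ([]; _∷_; here; there)
import Data.Vec.Properties as Vec
open import Function using (_∘_; _on_; _⇔_; Injective)
open import Relation.Binary using (Rel; Setoid; IsEquivalence)
import Relation.Binary.Construct.On as On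
import Relation.Binary.Reasoning.Setoid as SetoidReasoning
open import Relation.Binary.PropositionalEquality as ≡ using (_≡_; _≢_)
open import Relation.Nullary using (¬_; does)
open import Relation.Unary using (Pred; Decidable; Satisfiable; _≐_)

open Irrelevant using ([_])

-- z ∈ x ⊞ y is written (x ⊞ y) z.
record Hyperfield c ℓ h : Set (suc (c ⊔ ℓ ⊔ h)) where
  infix  8 -_
  infixl 7 _⊙_
  infixl 6 _⊞_
  infix  4 _≈_ _≉_
  field
    Carrier : Set c
    _≈_     : Rel Carrier ℓ
    _⊞_     : Carrier → Carrier → Pred Carrier h
    _⊙_     : Op₂ Carrier
    -_      : Op₁ Carrier
    0# 1#   : Carrier

  _≉_ : Rel Carrier ℓ
  x ≉ y = ¬ (x ≈ y)

  field
    0≉1        : 0# ≉ 1#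
    ⊞-resp-≈   : ∀ {x x′ y y′ z z′} → x ≈ x′ → y ≈ y′ → z ≈ z′ → (x ⊞ y) z → (x′ ⊞ y′) z′
    ⊞-nonempty : ∀ x y → ∃⟨ x ⊞ y ⟩
    ⊞-comm     : ∀ x y → x ⊞ y ≐ y ⊞ x
    ⊞-assoc    : ∀ x y z → (λ w → ∃ λ u → (x ⊞ y) u × (u ⊞ z) w)
                         ≐ (λ w → ∃ λ v → (y ⊞ z) v × (x ⊞ v) w)
    ⊞-identity : ∀ x → (0# ⊞ x) ≐ (x ≈_)
    ⊞-inverse  : ∀ x → (x ⊞ - x) 0#
    -‿unique   : ∀ {x y} → (x ⊞ y) 0# → y ≈ - x
    reversible : ∀ {x y z} → (y ⊞ z) x ⇔ (x ⊞ - y) z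

    ⊙-isCommutativeMonoid : IsCommutativeMonoid _≈_ _⊙_ 1#
    zeroˡ      : ∀ x → 0# ⊙ x ≈ 0#
    distribˡ   : ∀ a x y → (λ w → ∃ λ z → (x ⊞ y) z × w ≈ a ⊙ z) ≐ (a ⊙ x ⊞ a ⊙ y)
    -- Closure of the nonzero elements under _⊙_ and inversion follows; see ℍ*.
    ⊙-inverse  : ∀ {x} → x ≉ 0# → ∃ λ y → y ⊙ x ≈ 1#

  open IsCommutativeMonoid ⊙-isCommutativeMonoid public

  ⊙-commutativeSemigroup : CommutativeSemigroup c ℓ
  ⊙-commutativeSemigroup = record { isCommutativeSemigroup = isCommutativeSemigroup }

  -- (⊞∑ as) z means z ∈ a₁ ⊞ (a₂ ⊞ (… ⊞ aₘ)); the empty hypersum is { 0 }.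
  data ⊞∑ : List Carrier → Pred Carrier (c ⊔ ℓ ⊔ h) where
    []  : ∀ {z} → z ≈ 0# → ⊞∑ [] z
    _∷_ : ∀ {a as y z} → (a ⊞ y) z → ⊞∑ as y → ⊞∑ (a ∷ as) z

  zeroʳ : ∀ x → x ⊙ 0# ≈ 0#
  zeroʳ x = trans (comm x 0#) (zeroˡ x)

  ⊙-≉0 : ∀ {x y} → x ≉ 0# → y ≉ 0# → x ⊙ y ≉ 0#
  ⊙-≉0 {x} {y} x≉0 y≉0 xy≈0 with x′ , x′x≈1 ← ⊙-inverse x≉0 = y≉0 (begin
    y              ≈⟨ identityˡ y ⟨
    1# ⊙ y         ≈⟨ ∙-congʳ x′x≈1 ⟨
    (x′ ⊙ x) ⊙ y   ≈⟨ assoc x′ x y ⟩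
    x′ ⊙ (x ⊙ y)   ≈⟨ ∙-congˡ xy≈0 ⟩
    x′ ⊙ 0#        ≈⟨ zeroʳ x′ ⟩
    0#             ∎)
    where open SetoidReasoning setoid

  ⊙-≉0ˡ : ∀ {x y} → x ⊙ y ≈ 1# → x ≉ 0#
  ⊙-≉0ˡ {x} {y} xy≈1 x≈0 = 0≉1 (trans (sym (zeroˡ y)) (trans (∙-congʳ (sym x≈0)) xy≈1))

  -‿≉0 : ∀ {x} → x ≉ 0# → - x ≉ 0#
  -‿≉0 {x} x≉0 -x≈0 = x≉0 (proj₁ (⊞-identity x)
    (proj₁ (⊞-comm x 0#) (⊞-resp-≈ refl -x≈0 refl (⊞-inverse x))))

  -- The nonzero elements. Neither this type nor its equality unfolds (no eta,
  -- operations by copatterns), so that implicit arguments can be inferred.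
  record Nonzero : Set (c ⊔ ℓ) where
    no-eta-equality
    constructor _,_
    field
      val   : Carrier
      val≉0 : val ≉ 0#
  open Nonzero public

  infix 4 _≈*_
  record _≈*_ (x y : Nonzero) : Set ℓ where
    no-eta-equality
    pattern
    constructor ⟪_⟫
    field ≈*⇒≈ : val x ≈ val y
  open _≈*_ public

  infixl 7 _⊙*_
  infix  8 _⁻¹*
  infix  8 -*_

  _⊙*_ : Op₂ Nonzero
  val   (x ⊙* y) = val x ⊙ val y
  val≉0 (x ⊙* y) = ⊙-≉0 (val≉0 x) (val≉0 y)

  1* : Nonzero
  val   1* = 1#
  val≉0 1* = 0≉1 ∘ sym

  _⁻¹* : Op₁ Nonzero
  val   (x ⁻¹*) = proj₁ (⊙-inverse (val≉0 x))
  val≉0 (x ⁻¹*) = ⊙-≉0ˡ (proj₂ (⊙-inverse (val≉0 x)))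

  -*_ : Op₁ Nonzero
  val   (-* x) = - val x
  val≉0 (-* x) = -‿≉0 (val≉0 x)

  ℍ* : AbelianGroup (c ⊔ ℓ) ℓ
  ℍ* = record
    { Carrier = Nonzero ; _≈_ = _≈*_ ; _∙_ = _⊙*_ ; ε = 1* ; _⁻¹ = _⁻¹*
    ; isAbelianGroup = record
      { isGroup = record
        { isMonoid = record
          { isSemigroup = record
            { isMagma = record
              { isEquivalence = record
                { refl  = ⟪ refl ⟫
                ; sym   = λ x≈y → ⟪ sym (≈*⇒≈ x≈y) ⟫
                ; trans = λ x≈y y≈z → ⟪ trans (≈*⇒≈ x≈y) (≈*⇒≈ y≈z) ⟫
                }
              ; ∙-cong = λ x≈y u≈v → ⟪ ∙-cong (≈*⇒≈ x≈y) (≈*⇒≈ u≈v) ⟫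
              }
            ; assoc = λ x y z → ⟪ assoc (val x) (val y) (val z) ⟫
            }
          ; identity = (λ x → ⟪ identityˡ (val x) ⟫) , (λ x → ⟪ identityʳ (val x) ⟫)
          }
        ; inverse = (λ x → ⟪ proj₂ (⊙-inverse (val≉0 x)) ⟫)
                  , (λ x → ⟪ trans (comm _ _) (proj₂ (⊙-inverse (val≉0 x))) ⟫)
        ; ⁻¹-cong = λ {x} {y} x≈y → ⟪ ⁻¹-cong (val≉0 x) (val≉0 y) (≈*⇒≈ x≈y) ⟫
        }
      ; comm = λ x y → ⟪ comm (val x) (val y) ⟫
      }
    }
    where
    ⁻¹-cong : ∀ {x y} (x≉0 : x ≉ 0#) (y≉0 : y ≉ 0#) → x ≈ y →
              proj₁ (⊙-inverse x≉0) ≈ proj₁ (⊙-inverse y≉0)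
    ⁻¹-cong {x} {y} x≉0 y≉0 x≈y
      with x′ , x′x≈1 ← ⊙-inverse x≉0 | y′ , y′y≈1 ← ⊙-inverse y≉0 = begin
      x′             ≈⟨ identityʳ x′ ⟨
      x′ ⊙ 1#        ≈⟨ ∙-congˡ (trans (comm y y′) y′y≈1) ⟨
      x′ ⊙ (y ⊙ y′)  ≈⟨ assoc x′ y y′ ⟨
      (x′ ⊙ y) ⊙ y′  ≈⟨ ∙-congʳ (trans (∙-congˡ (sym x≈y)) x′x≈1) ⟩
      1# ⊙ y′        ≈⟨ identityˡ y′ ⟩
      y′             ∎
      where open SetoidReasoning setoid

  ⊞∑-resp-≈ : ∀ {A : Set} {f g : A → Carrier} {z z′} as → (∀ a → f a ≈ g a) → z ≈ z′ →
              ⊞∑ (map f as) z → ⊞∑ (map g as) z′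
  ⊞∑-resp-≈ []       f≈g z≈z′ ([] z≈0)  = [] (trans (sym z≈z′) z≈0)
  ⊞∑-resp-≈ (a ∷ as) f≈g z≈z′ (z∈ ∷ y∈) =
    ⊞-resp-≈ (f≈g a) refl z≈z′ z∈ ∷ ⊞∑-resp-≈ as f≈g refl y∈

  ⊞∑-scale : ∀ {A : Set} {f : A → Carrier} {z} b as → ⊞∑ (map f as) z →
             ⊞∑ (map (λ a → b ⊙ f a) as) (b ⊙ z)
  ⊞∑-scale b []       ([] z≈0)  = [] (trans (∙-congˡ z≈0) (zeroʳ b))
  ⊞∑-scale b (a ∷ as) (z∈ ∷ y∈) = proj₁ (distribˡ b _ _) (_ , z∈ , refl) ∷ ⊞∑-scale b as y∈

record Involution {c ℓ h} (ℍ : Hyperfield c ℓ h) : Set (c ⊔ ℓ ⊔ h) where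
  open Hyperfield ℍ
  field
    τ            : Op₁ Carrier
    τ-cong       : ∀ {x y} → x ≈ y → τ x ≈ τ y
    τ-0          : τ 0# ≈ 0#
    τ-1          : τ 1# ≈ 1#
    τ-⊙          : ∀ x y → τ (x ⊙ y) ≈ τ x ⊙ τ y
    τ-⊞          : ∀ {x y z} → (x ⊞ y) z → (τ x ⊞ τ y) (τ z)
    τ-involutive : ∀ x → τ (τ x) ≈ x

  τ* : Op₁ Nonzero
  val   (τ* x) = τ (val x)
  val≉0 (τ* x) τx≈0 =
    val≉0 x (trans (sym (τ-involutive (val x))) (trans (τ-cong τx≈0) τ-0))

-- Decidability of independence holds automatically in classical logic.
record Matroid (n : ℕ) : Set₁ where
  field
    Indep     : Pred (Subset n) 0ℓ
    indep?    : Decidable Indep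
    ∅-indep   : Indep ∅
    ⊆-indep   : ∀ {I J} → J ⊆ I → Indep I → Indep J
    augment   : ∀ {I J} → Indep I → Indep J → ∣ I ∣ < ∣ J ∣ →
                ∃ λ x → x ∈ J × x ∉ I × Indep (I ∪ ⁅ x ⁆)

  IsBasis : Pred (Subset n) 0ℓ
  IsBasis B = Indep B × (∀ {I} → Indep I → B ⊆ I → I ⊆ B)

  -- Independence in the dual matroid, whose bases are the complements of bases.
  Coindep : Pred (Subset n) 0ℓ
  Coindep I = ∃ λ B → IsBasis B × I ⊆ ∁ B

  IsCircuit : Pred (Subset n) 0ℓ
  IsCircuit C = ¬ Indep C × (∀ {I} → I ⊂ C → Indep I)

  IsCocircuit : Pred (Subset n) 0ℓ
  IsCocircuit D = ¬ Coindep D × (∀ {I} → I ⊂ D → Coindep I)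

  -- Refinement types: a circuit is determined by its underlying set.
  Circuit Cocircuit : Set
  Circuit   = [ C ∈ Subset n ∣ IsCircuit C ]
  Cocircuit = [ D ∈ Subset n ∣ IsCocircuit D ]

module _ {n : ℕ} where

  Elem : Subset n → Set
  Elem p = [ x ∈ Fin n ∣ x ∈ p ]

  inˡ : ∀ p q → Elem (p ∩ q) → Elem p
  inˡ p q (x , [ x∈ ]) = x , [ p∩q⊆p p q x∈ ]

  inʳ : ∀ p q → Elem (p ∩ q) → Elem q
  inʳ p q (x , [ x∈ ]) = x , [ p∩q⊆q p q x∈ ]

  Enumerates : ∀ {m} → Subset n → (Fin m → Fin n) → Set
  Enumerates p x = Injective _≡_ _≡_ x × (∀ e → e ∈ p ⇔ ∃ λ i → x i ≡ e)

elements : ∀ {n} (p : Subset n) → List (Elem p)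
elements []      = []
elements (s ∷ p) = first s (map (λ (x , [ x∈p ]) → Fin.suc x , [ there x∈p ]) (elements p))
  where
  first : ∀ s → List (Elem (s ∷ p)) → List (Elem (s ∷ p))
  first inside  xs = (Fin.zero , [ here ]) ∷ xs
  first outside xs = xs

data Word (X : Set) : Set where
  gen : X → Word X
  1ʷ  : Word X
  _·_ : Word X → Word X → Word X
  _⁻  : Word X → Word X

infixl 7 _·_
infix  8 _⁻

module Presentation {X : Set} (_∼_ : Rel (Word X) 0ℓ) where

  infix 4 _≋_
  data _≋_ : Rel (Word X) 0ℓ where
    rel       : ∀ {u v} → u ∼ v → u ≋ v
    ≋-refl    : ∀ {u} → u ≋ u
    ≋-sym     : ∀ {u v} → u ≋ v → v ≋ u
    ≋-trans   : ∀ {u v w} → u ≋ v → v ≋ w → u ≋ w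
    ·-cong    : ∀ {u u′ v v′} → u ≋ u′ → v ≋ v′ → u · v ≋ u′ · v′
    ⁻-cong    : ∀ {u v} → u ≋ v → u ⁻ ≋ v ⁻
    ·-assoc   : ∀ u v w → (u · v) · w ≋ u · (v · w)
    ·-comm    : ∀ u v → u · v ≋ v · u
    identityˡ : ∀ u → 1ʷ · u ≋ u
    inverseˡ  : ∀ u → u ⁻ · u ≋ 1ʷ

  presented : AbelianGroup 0ℓ 0ℓ
  presented = record
    { Carrier = Word X ; _≈_ = _≋_ ; _∙_ = _·_ ; ε = 1ʷ ; _⁻¹ = _⁻
    ; isAbelianGroup = record
      { isGroup = record
        { isMonoid = record
          { isSemigroup = record
            { isMagma = record
              { isEquivalence = record { refl = ≋-refl ; sym = ≋-sym ; trans = ≋-trans }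
              ; ∙-cong        = ·-cong
              }
            ; assoc = ·-assoc
            }
          ; identity = identityˡ , λ u → ≋-trans (·-comm u 1ʷ) (identityˡ u)
          }
        ; inverse = inverseˡ , λ u → ≋-trans (·-comm u (u ⁻)) (inverseˡ u)
        ; ⁻¹-cong = ⁻-cong
        }
      ; comm = ·-comm
      }
    }

  module _ {c ℓ} (G : AbelianGroup c ℓ) (f : X → AbelianGroup.Carrier G) where
    private module G = AbelianGroup G

    eval : Word X → G.Carrier
    eval (gen x) = f x
    eval 1ʷ      = G.ε
    eval (u · v) = eval u G.∙ eval v
    eval (u ⁻)   = eval u G.⁻¹

    module _ (f-rel : ∀ {u v} → u ∼ v → eval u G.≈ eval v) where

      eval-cong : ∀ {u v} → u ≋ v → eval u G.≈ eval v
      eval-cong (rel r)         = f-rel r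
      eval-cong ≋-refl          = G.refl
      eval-cong (≋-sym p)       = G.sym (eval-cong p)
      eval-cong (≋-trans p q)   = G.trans (eval-cong p) (eval-cong q)
      eval-cong (·-cong p q)    = G.∙-cong (eval-cong p) (eval-cong q)
      eval-cong (⁻-cong p)      = G.⁻¹-cong (eval-cong p)
      eval-cong (·-assoc u v w) = G.assoc (eval u) (eval v) (eval w)
      eval-cong (·-comm u v)    = G.comm (eval u) (eval v)
      eval-cong (identityˡ u)   = G.identityˡ (eval u)
      eval-cong (inverseˡ u)    = G.inverseˡ (eval u)

      extend : GroupHomomorphism (AbelianGroup.rawGroup presented) G.rawGroup
      extend = record
        { ⟦_⟧ = eval
        ; isGroupHomomorphism = record
          { isMonoidHomomorphism = record
            { isMagmaHomomorphism = record
              { isRelHomomorphism = record { cong = eval-cong }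
              ; homo              = λ _ _ → G.refl
              }
            ; ε-homo = G.refl
            }
          ; ⁻¹-homo = λ _ → G.refl
          }
        }

module _ {c ℓ} (G : AbelianGroup c ℓ) where
  open AbelianGroup G

  record IsSubgroup {p} (P : Pred Carrier p) : Set (c ⊔ ℓ ⊔ p) where
    field
      resp : ∀ {x y} → x ≈ y → P x → P y
      ε∈   : P ε
      ∙∈   : ∀ {x y} → P x → P y → P (x ∙ y)
      ⁻¹∈  : ∀ {x} → P x → P (x ⁻¹)

  module _ {p} {P : Pred Carrier p} (P-isSubgroup : IsSubgroup P) where
    open IsSubgroup P-isSubgroup

    subgroup : AbelianGroup (c ⊔ p) ℓ
    subgroup = record
      { isAbelianGroup = GroupMonomorphism.isAbelianGroup proj₁-mono isAbelianGroup }
      where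
      raw : RawGroup (c ⊔ p) ℓ
      raw = record
        { Carrier = ∃ P
        ; _≈_     = _≈_ on proj₁
        ; _∙_     = λ (x , x∈) (y , y∈) → x ∙ y , ∙∈ x∈ y∈
        ; ε       = ε , ε∈
        ; _⁻¹     = λ (x , x∈) → x ⁻¹ , ⁻¹∈ x∈
        }
      proj₁-mono : IsGroupMonomorphism raw rawGroup proj₁
      proj₁-mono = record
        { isGroupHomomorphism = record
          { isMonoidHomomorphism = record
            { isMagmaHomomorphism = record
              { isRelHomomorphism = record { cong = λ x≈y → x≈y }
              ; homo              = λ _ _ → refl
              }
            ; ε-homo = refl
            }
          ; ⁻¹-homo = λ _ → refl
          }
        ; injective = λ x≈y → x≈y
        }

  data Generated {s} (S : Pred Carrier s) : Pred Carrier (c ⊔ ℓ ⊔ s) where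
    gen  : ∀ {x} → S x → Generated S x
    resp : ∀ {x y} → x ≈ y → Generated S x → Generated S y
    ε∈   : Generated S ε
    ∙∈   : ∀ {x y} → Generated S x → Generated S y → Generated S (x ∙ y)
    ⁻¹∈  : ∀ {x} → Generated S x → Generated S (x ⁻¹)

  generated-isSubgroup : ∀ {s} (S : Pred Carrier s) → IsSubgroup (Generated S)
  generated-isSubgroup S = record { resp = resp ; ε∈ = ε∈ ; ∙∈ = ∙∈ ; ⁻¹∈ = ⁻¹∈ }

  module _ {c′ ℓ′} (K : AbelianGroup c′ ℓ′)
           (φ : GroupHomomorphism rawGroup (AbelianGroup.rawGroup K)) where
    private
      module K = AbelianGroup K
      module KP = AbelianGroupProperties K
    open GroupHomomorphism φ

    Kernel : Pred Carrier ℓ′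
    Kernel x = ⟦ x ⟧ K.≈ K.ε

    kernel-isSubgroup : IsSubgroup Kernel
    kernel-isSubgroup = record
      { resp = λ x≈y x∈ → K.trans (⟦⟧-cong (sym x≈y)) x∈
      ; ε∈   = ε-homo
      ; ∙∈   = λ x∈ y∈ → K.trans (homo _ _) (K.trans (K.∙-cong x∈ y∈) (K.identityˡ K.ε))
      ; ⁻¹∈  = λ x∈ → K.trans (⁻¹-homo _) (K.trans (K.⁻¹-cong x∈) KP.ε⁻¹≈ε)
      }

-- What is needed of a group in order to speak of the conditions (𝓢) and (𝓦)
-- for a homomorphism defined on it: the elements ε_M and
-- crossRatio C C′ x y = C(x) C′(y) / C(y) C′(x).
record CrossRatioGroup {n} (M : Matroid n) : Set₁ where
  open Matroid M
  field
    group      : AbelianGroup 0ℓ 0ℓ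
    εᴹ         : AbelianGroup.Carrier group
    crossRatio : (C C′ : Circuit) (x y : Elem (value C ∩ value C′)) →
                 AbelianGroup.Carrier group
  open AbelianGroup group public using (rawGroup)

module Tutte {n} (M : Matroid n) where
  open Matroid M

  data Generator : Set where
    epsilon : Generator
    _at_    : (C : Circuit) → Elem (value C) → Generator
    _at*_   : (D : Cocircuit) → Elem (value D) → Generator

  ε₀ : Word Generator
  ε₀ = gen epsilon

  _⟨_⟩ : (C : Circuit) → Elem (value C) → Word Generator
  C ⟨ x ⟩ = gen (C at x)

  _⟨_⟩* : (D : Cocircuit) → Elem (value D) → Word Generator
  D ⟨ y ⟩* = gen (D at* y)

  pairing : (C : Circuit) (D : Cocircuit) → Elem (value C ∩ value D) → Word Generator
  pairing C D x = C ⟨ inˡ (value C) (value D) x ⟩ · D ⟨ inʳ (value C) (value D) x ⟩*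

  data Relation : Rel (Word Generator) 0ℓ where
    ε²       : Relation (ε₀ · ε₀) 1ʷ
    exchange : ∀ C D (x y : Elem (value C ∩ value D)) → value x ≢ value y →
               value C ∩ value D ≡ ⁅ value x ⁆ ∪ ⁅ value y ⁆ →
               Relation (pairing C D x) (ε₀ · pairing C D y)

  open Presentation Relation

  -- 𝕋_M^{𝔆,𝔆*}
  𝕋ᶜ : AbelianGroup 0ℓ 0ℓ
  𝕋ᶜ = presented
  private module 𝕋ᶜ = AbelianGroup 𝕋ᶜ

  data TutteGenerator : Pred (Word Generator) 0ℓ where
    ε-gen         : TutteGenerator ε₀
    circuit-gen   : ∀ C x y → TutteGenerator (C ⟨ x ⟩ · C ⟨ y ⟩ ⁻)
    cocircuit-gen : ∀ D x y → TutteGenerator (D ⟨ x ⟩* · D ⟨ y ⟩* ⁻)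

  InTutte : Pred (Word Generator) 0ℓ
  InTutte = Generated 𝕋ᶜ TutteGenerator

  Degrees : AbelianGroup 0ℓ 0ℓ
  Degrees = ℤ^ Fin n ⊗ (ℤ^ Circuit ⊗ ℤ^ Cocircuit)
    where
    infix  7 ℤ^_
    infixr 6 _⊗_
    ℤ^_ : Set → AbelianGroup 0ℓ 0ℓ
    ℤ^ A = Pointwise.abelianGroup A ℤ.+-0-abelianGroup
    _⊗_ : AbelianGroup 0ℓ 0ℓ → AbelianGroup 0ℓ 0ℓ → AbelianGroup 0ℓ 0ℓ
    _⊗_ = DirectProduct.abelianGroup
  private module Degrees = AbelianGroup Degrees

  𝟙ᴱ : Fin n → Fin n → ℤ
  𝟙ᴱ x e = if does (x Fin.≟ e) then 1ℤ else 0ℤ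
    where open Bool using (if_then_else_)

  𝟙ˢ : {P : Pred (Subset n) 0ℓ} → Refinement (Subset n) P → Refinement (Subset n) P → ℤ
  𝟙ˢ A B = if does (Vec.≡-dec Bool._≟_ (value A) (value B)) then 1ℤ else 0ℤ
    where open Bool using (if_then_else_)

  degree₀ : Generator → Degrees.Carrier
  degree₀ epsilon   = (λ _ → 0ℤ) , (λ _ → 0ℤ) , (λ _ → 0ℤ)
  degree₀ (C at x)  = 𝟙ᴱ (value x) , 𝟙ˢ C , (λ _ → 0ℤ)
  degree₀ (D at* y) = (λ e → ℤ.- 𝟙ᴱ (value y) e) , (λ _ → 0ℤ) , 𝟙ˢ D

  degree₀-relation : ∀ {u v} → Relation u v →
    eval Degrees degree₀ u Degrees.≈ eval Degrees degree₀ v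
  degree₀-relation ε² = (λ _ → ≡.refl) , (λ _ → ≡.refl) , (λ _ → ≡.refl)
  degree₀-relation (exchange C D x y _ _) =
      (λ e → ≡.trans (ℤ.+-inverseʳ (𝟙ᴱ (value x) e))
               (≡.sym (≡.trans (ℤ.+-identityˡ _) (ℤ.+-inverseʳ (𝟙ᴱ (value y) e)))))
    , (λ _ → ≡.sym (ℤ.+-identityˡ _))
    , (λ _ → ≡.sym (ℤ.+-identityˡ _))

  degree : GroupHomomorphism 𝕋ᶜ.rawGroup Degrees.rawGroup
  degree = extend Degrees degree₀ degree₀-relation

  InInner : Pred (Word Generator) 0ℓ
  InInner = Kernel 𝕋ᶜ Degrees degree

  crossRatioᶜ : (C C′ : Circuit) (x y : Elem (value C ∩ value C′)) → Word Generator
  crossRatioᶜ C C′ x y = (C ⟨ ˡ x ⟩ · C′ ⟨ ʳ y ⟩) · (C ⟨ ˡ y ⟩ · C′ ⟨ ʳ x ⟩) ⁻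
    where
    ˡ = inˡ (value C) (value C′)
    ʳ = inʳ (value C) (value C′)

  crossRatio-inTutte : ∀ C C′ x y → InTutte (crossRatioᶜ C C′ x y)
  crossRatio-inTutte C C′ x y = resp eq
    (∙∈ (gen (circuit-gen C (ˡ x) (ˡ y))) (gen (circuit-gen C′ (ʳ y) (ʳ x))))
    where
    ˡ = inˡ (value C) (value C′)
    ʳ = inʳ (value C) (value C′)
    open AbelianGroupProperties 𝕋ᶜ using (⁻¹-∙-comm)
    open CommutativeSemigroupProperties 𝕋ᶜ.commutativeSemigroup using (interchange)
    eq : (C ⟨ ˡ x ⟩ · C ⟨ ˡ y ⟩ ⁻) · (C′ ⟨ ʳ y ⟩ · C′ ⟨ ʳ x ⟩ ⁻) 𝕋ᶜ.≈ crossRatioᶜ C C′ x y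
    eq = 𝕋ᶜ.trans (interchange _ _ _ _) (𝕋ᶜ.∙-congˡ (⁻¹-∙-comm _ _))

  crossRatio-inInner : ∀ C C′ x y → InInner (crossRatioᶜ C C′ x y)
  crossRatio-inInner C C′ x y =
      (λ e → ≡.trans (≡.cong (λ i → 𝟙ᴱ (value x) e ℤ.+ 𝟙ᴱ (value y) e ℤ.- i)
                        (ℤ.+-comm (𝟙ᴱ (value y) e) (𝟙ᴱ (value x) e)))
                (ℤ.+-inverseʳ (𝟙ᴱ (value x) e ℤ.+ 𝟙ᴱ (value y) e)))
    , (λ B → ℤ.+-inverseʳ (𝟙ˢ C B ℤ.+ 𝟙ˢ C′ B))
    , (λ _ → ≡.refl)

  extendedTutteGroup tutteGroup innerTutteGroup : CrossRatioGroup M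
  extendedTutteGroup = record
    { group      = 𝕋ᶜ
    ; εᴹ         = ε₀
    ; crossRatio = crossRatioᶜ
    }
  tutteGroup = record
    { group      = subgroup 𝕋ᶜ (generated-isSubgroup 𝕋ᶜ TutteGenerator)
    ; εᴹ         = ε₀ , gen ε-gen
    ; crossRatio = λ C C′ x y → crossRatioᶜ C C′ x y , crossRatio-inTutte C C′ x y
    }
  innerTutteGroup = record
    { group      = subgroup 𝕋ᶜ (kernel-isSubgroup 𝕋ᶜ Degrees degree)
    ; εᴹ         = ε₀ , (λ _ → ≡.refl) , (λ _ → ≡.refl) , (λ _ → ≡.refl)
    ; crossRatio = λ C C′ x y → crossRatioᶜ C C′ x y , crossRatio-inInner C C′ x y
    }

data Strength : Set where
  strong weak : Strength

module HyperfieldMatroids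
  {n} (M : Matroid n) {c ℓ h} (ℍ : Hyperfield c ℓ h) (involution : Involution ℍ) where

  open Matroid M
  open Tutte M
  open Hyperfield ℍ
  open Involution involution
  module ℍ* = AbelianGroup ℍ*

  record Signatures : Set (c ⊔ ℓ) where
    constructor _,_
    field
      γ : (C : Circuit) → Elem (value C) → ℍ*.Carrier
      δ : (D : Cocircuit) → Elem (value D) → ℍ*.Carrier
  open Signatures public

  terms : Signatures → ∀ C D → Elem (value C ∩ value D) → Carrier
  terms p C D x = val (γ p C (inˡ (value C) (value D) x))
                ⊙ τ (val (δ p D (inʳ (value C) (value D) x)))

  OrthogonalAt : Signatures → Circuit → Cocircuit → Set (c ⊔ ℓ ⊔ h)
  OrthogonalAt p C D = ⊞∑ (map (terms p C D) (elements (value C ∩ value D))) 0#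

  Orthogonal : Strength → Pred Signatures (c ⊔ ℓ ⊔ h)
  Orthogonal strong p = ∀ C D → OrthogonalAt p C D
  Orthogonal weak   p = ∀ C D → ∣ value C ∩ value D ∣ ≤ 3 → OrthogonalAt p C D

  infix 4 _≈ˢ_ _∼_ _≈τ_

  _≈ˢ_ : Rel Signatures ℓ
  p ≈ˢ q = (∀ C x → γ p C x ℍ*.≈ γ q C x) × (∀ D y → δ p D y ℍ*.≈ δ q D y)

  _∼_ : Rel Signatures (c ⊔ ℓ)
  p ∼ q = ∃₂ λ (b : Circuit → ℍ*.Carrier) (l : Cocircuit → ℍ*.Carrier) →
      (∀ C x → γ p C x ℍ*.≈ b C ℍ*.∙ γ q C x)
    × (∀ D y → δ p D y ℍ*.≈ l D ℍ*.∙ δ q D y)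

  _≈τ_ : Rel Signatures (c ⊔ ℓ)
  p ≈τ q = ∃ λ (η : Fin n → ℍ*.Carrier) →
      (∀ C x → γ p C x ℍ*.≈ η (value x) ℍ*.∙ γ q C x)
    × (∀ D y → δ p D y ℍ*.≈ τ* (η (value y) ℍ*.⁻¹) ℍ*.∙ δ q D y)

  -- The ∼-classes of p and q have ≈τ-equivalent representatives.
  Cong : Strength → Rel Signatures (c ⊔ ℓ ⊔ h)
  Cong s p q = ∃₂ λ p′ q′ → Orthogonal s p′ × Orthogonal s q′ × p ∼ p′ × p′ ≈τ q′ × q′ ∼ q

  module SignatureProperties where
    open CommutativeSemigroupProperties ℍ*.commutativeSemigroup
      using (x∙yz≈y∙xz)
    open AbelianGroupProperties ℍ* using (⁻¹-∙-comm; ε⁻¹≈ε)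

    cancel : ∀ {a b x y} → b ℍ*.∙ a ℍ*.≈ ℍ*.ε → x ℍ*.≈ a ℍ*.∙ y → y ℍ*.≈ b ℍ*.∙ x
    cancel ba≈1 x≈ay = ℍ*.trans (ℍ*.sym (ℍ*.identityˡ _)) (ℍ*.trans (ℍ*.∙-congʳ (ℍ*.sym ba≈1))
      (ℍ*.trans (ℍ*.assoc _ _ _) (ℍ*.∙-congˡ (ℍ*.sym x≈ay))))

    compose : ∀ {a b x y z} → x ℍ*.≈ a ℍ*.∙ y → y ℍ*.≈ b ℍ*.∙ z → x ℍ*.≈ (a ℍ*.∙ b) ℍ*.∙ z
    compose x≈ay y≈bz =
      ℍ*.trans x≈ay (ℍ*.trans (ℍ*.∙-congˡ y≈bz) (ℍ*.sym (ℍ*.assoc _ _ _)))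

    ∼-refl : ∀ {p} → p ∼ p
    ∼-refl = (λ _ → ℍ*.ε) , (λ _ → ℍ*.ε)
           , (λ _ _ → ℍ*.sym (ℍ*.identityˡ _)) , (λ _ _ → ℍ*.sym (ℍ*.identityˡ _))

    ∼-sym : ∀ {p q} → p ∼ q → q ∼ p
    ∼-sym (b , l , γ≈ , δ≈) = (λ C → b C ℍ*.⁻¹) , (λ D → l D ℍ*.⁻¹)
      , (λ C x → cancel (ℍ*.inverseˡ (b C)) (γ≈ C x))
      , (λ D y → cancel (ℍ*.inverseˡ (l D)) (δ≈ D y))

    ∼-trans : ∀ {p q r} → p ∼ q → q ∼ r → p ∼ r
    ∼-trans (b , l , γ≈ , δ≈) (b′ , l′ , γ≈′ , δ≈′) =
        (λ C → b C ℍ*.∙ b′ C) , (λ D → l D ℍ*.∙ l′ D)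
      , (λ C x → compose (γ≈ C x) (γ≈′ C x)) , (λ D y → compose (δ≈ D y) (δ≈′ D y))

    τ*-inverse : ∀ x → τ* (x ℍ*.⁻¹ ℍ*.⁻¹) ℍ*.∙ τ* (x ℍ*.⁻¹) ℍ*.≈ ℍ*.ε
    τ*-inverse x = ⟪ trans (sym (τ-⊙ _ _)) (trans (τ-cong (≈*⇒≈ (ℍ*.inverseˡ (x ℍ*.⁻¹)))) τ-1) ⟫

    τ*-⁻¹-∙ : ∀ x y → τ* (x ℍ*.⁻¹) ℍ*.∙ τ* (y ℍ*.⁻¹) ℍ*.≈ τ* ((x ℍ*.∙ y) ℍ*.⁻¹)
    τ*-⁻¹-∙ x y = ⟪ trans (sym (τ-⊙ _ _)) (τ-cong (≈*⇒≈ (⁻¹-∙-comm x y))) ⟫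

    ≈τ-refl : ∀ {p} → p ≈τ p
    ≈τ-refl = (λ _ → ℍ*.ε) , (λ _ _ → ℍ*.sym (ℍ*.identityˡ _))
      , λ _ _ → ℍ*.trans (ℍ*.sym (ℍ*.identityˡ _)) (ℍ*.∙-congʳ
          ⟪ sym (trans (τ-cong (≈*⇒≈ ε⁻¹≈ε)) τ-1) ⟫)

    ≈τ-sym : ∀ {p q} → p ≈τ q → q ≈τ p
    ≈τ-sym (η , γ≈ , δ≈) = (λ e → η e ℍ*.⁻¹)
      , (λ C x → cancel (ℍ*.inverseˡ (η (value x))) (γ≈ C x))
      , (λ D y → cancel (τ*-inverse (η (value y))) (δ≈ D y))

    ≈τ-trans : ∀ {p q r} → p ≈τ q → q ≈τ r → p ≈τ r
    ≈τ-trans (η , γ≈ , δ≈) (η′ , γ≈′ , δ≈′) = (λ e → η e ℍ*.∙ η′ e)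
      , (λ C x → compose (γ≈ C x) (γ≈′ C x))
      , (λ D y → ℍ*.trans (compose (δ≈ D y) (δ≈′ D y)) (ℍ*.∙-congʳ (τ*-⁻¹-∙ _ _)))

    orthogonalAt-∼ : ∀ {p q} C D → p ∼ q → OrthogonalAt q C D → OrthogonalAt p C D
    orthogonalAt-∼ {p} {q} C D (b , l , γ≈ , δ≈) q⊥ =
      ⊞∑-resp-≈ (elements (value C ∩ value D)) eq (zeroʳ a)
        (⊞∑-scale a (elements (value C ∩ value D)) q⊥)
      where
      open CommutativeSemigroupProperties ⊙-commutativeSemigroup using (interchange)
      a : Carrier
      a = val (b C) ⊙ τ (val (l D))
      eq : ∀ x → a ⊙ terms q C D x ≈ terms p C D x
      eq x = trans (interchange _ _ _ _)
        (sym (∙-cong (≈*⇒≈ (γ≈ C _)) (trans (τ-cong (≈*⇒≈ (δ≈ D _))) (τ-⊙ _ _))))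

    orthogonal-∼ : ∀ s {p q} → p ∼ q → Orthogonal s q → Orthogonal s p
    orthogonal-∼ strong p∼q q⊥ C D    = orthogonalAt-∼ C D p∼q (q⊥ C D)
    orthogonal-∼ weak   p∼q q⊥ C D ≤3 = orthogonalAt-∼ C D p∼q (q⊥ C D ≤3)

    exchange-∼≈τ : ∀ {p q r} → p ∼ q → q ≈τ r → ∃ λ q′ → p ≈τ q′ × q′ ∼ r
    exchange-∼≈τ {r = r} (b , l , γ≈ , δ≈) (η , γ≈′ , δ≈′) =
        ((λ C x → b C ℍ*.∙ γ r C x) , (λ D y → l D ℍ*.∙ δ r D y))
      , (η , (λ C x → ℍ*.trans (γ≈ C x) (ℍ*.trans (ℍ*.∙-congˡ (γ≈′ C x)) (x∙yz≈y∙xz _ _ _)))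
           , (λ D y → ℍ*.trans (δ≈ D y) (ℍ*.trans (ℍ*.∙-congˡ (δ≈′ D y)) (x∙yz≈y∙xz _ _ _))))
      , (b , l , (λ _ _ → ℍ*.refl) , (λ _ _ → ℍ*.refl))

    cong-trans : ∀ s {p q r} → Cong s p q → Cong s q r → Cong s p r
    cong-trans s (p₁ , _ , p₁⊥ , _ , p∼p₁ , p₁≈q₁ , q₁∼q) (_ , r₁ , _ , r₁⊥ , q∼q₂ , q₂≈r₁ , r₁∼r)
      with r₂ , q₁≈r₂ , r₂∼r₁ ← exchange-∼≈τ (∼-trans q₁∼q q∼q₂) q₂≈r₁ =
      p₁ , r₂ , p₁⊥ , orthogonal-∼ s r₂∼r₁ r₁⊥ , p∼p₁ , ≈τ-trans p₁≈q₁ q₁≈r₂ , ∼-trans r₂∼r₁ r₁∼r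

  open SignatureProperties

  -- Quotient sets are represented by setoids: all three setoids below have the
  -- orthogonal pairs as elements, and the hyperfield matroids and the rescaling
  -- classes are the equivalence classes of 𝓜 and 𝓡 respectively.
  𝓝 : Strength → Setoid (c ⊔ ℓ ⊔ h) ℓ
  𝓝 s = record
    { Carrier = ∃ (Orthogonal s)
    ; _≈_     = _≈ˢ_ on proj₁
    ; isEquivalence = record
      { refl  = (λ _ _ → ℍ*.refl) , (λ _ _ → ℍ*.refl)
      ; sym   = λ (γ≈ , δ≈) → (λ C x → ℍ*.sym (γ≈ C x)) , (λ D y → ℍ*.sym (δ≈ D y))
      ; trans = λ (γ≈ , δ≈) (γ≈′ , δ≈′) →
          (λ C x → ℍ*.trans (γ≈ C x) (γ≈′ C x)) , (λ D y → ℍ*.trans (δ≈ D y) (δ≈′ D y))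
      }
    }

  𝓜 : Strength → Setoid (c ⊔ ℓ ⊔ h) (c ⊔ ℓ)
  𝓜 s = record
    { Carrier       = ∃ (Orthogonal s)
    ; _≈_           = _∼_ on proj₁
    ; isEquivalence = record { refl = ∼-refl ; sym = ∼-sym ; trans = ∼-trans }
    }

  𝓡 : Strength → Setoid (c ⊔ ℓ ⊔ h) (c ⊔ ℓ ⊔ h)
  𝓡 s = record
    { Carrier       = ∃ (Orthogonal s)
    ; _≈_           = Cong s on proj₁
    ; isEquivalence = record
      { refl  = λ { {p , p⊥} → p , p , p⊥ , p⊥ , ∼-refl , ≈τ-refl , ∼-refl }
      ; sym   = λ (p′ , q′ , p′⊥ , q′⊥ , p∼p′ , p′≈q′ , q′∼q) →
          q′ , p′ , q′⊥ , p′⊥ , ∼-sym q′∼q , ≈τ-sym p′≈q′ , ∼-sym p∼p′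
      ; trans = cong-trans s
      }
    }

  -- Homomorphisms from a Tutte group to ℍ* are required to send ε_M to -1.
  -- This is essential: for M = U₁,₂ and ℍ a field of characteristic ≠ 2, the
  -- trivial homomorphism (vacuously) satisfies (𝓢), but defines γ = δ = 1,
  -- which are not orthogonal as 1 + 1 ≠ 0.
  record TutteHomomorphism (T : CrossRatioGroup M) : Set (c ⊔ ℓ) where
    open CrossRatioGroup T using (rawGroup; εᴹ)
    field
      homomorphism : GroupHomomorphism rawGroup ℍ*.rawGroup
    open GroupHomomorphism homomorphism public
    field
      εᴹ-homo : ⟦ εᴹ ⟧ ℍ*.≈ -* 1*
  open TutteHomomorphism public using (⟦_⟧)

  infix 4 _≗ᴴ_
  _≗ᴴ_ : ∀ {T} → Rel (TutteHomomorphism T) ℓ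
  Φ ≗ᴴ Ψ = ∀ t → ⟦ Φ ⟧ t ℍ*.≈ ⟦ Ψ ⟧ t

  module _ {T : CrossRatioGroup M} (Φ : TutteHomomorphism T) where
    open CrossRatioGroup T using (crossRatio)

    -- For fixed k: C ∩ D = {x₀, …, xₖ} and Cⱼ ∩ D = {x₀, xⱼ} imply
    -- 1 ∈ ⊞ⱼ Φ(C(xⱼ) Cⱼ(x₀) / C(x₀) Cⱼ(xⱼ)), where j runs over 1, …, k.
    ConditionAt : ℕ → Set (c ⊔ ℓ ⊔ h)
    ConditionAt k =
      (C : Circuit) (D : Cocircuit)
      (x : Fin (ℕ.suc k) → Fin n) (C∩D : Enumerates (value C ∩ value D) x)
      (C′ : Fin k → Circuit)
      (C′∩D : ∀ j → value (C′ j) ∩ value D ≡ ⁅ x Fin.zero ⁆ ∪ ⁅ x (Fin.suc j) ⁆) →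
      let x₀ : ∀ j → Elem (value C ∩ value (C′ j))
          x₀ j = common C D x C∩D (C′ j) Fin.zero
                   (≡.subst (x Fin.zero ∈_) (≡.sym (C′∩D j)) (x∈p∪q⁺ (inj₁ (x∈⁅x⁆ _))))
          xⱼ : ∀ j → Elem (value C ∩ value (C′ j))
          xⱼ j = common C D x C∩D (C′ j) (Fin.suc j)
                   (≡.subst (x (Fin.suc j) ∈_) (≡.sym (C′∩D j)) (x∈p∪q⁺ (inj₂ (x∈⁅x⁆ _))))
      in ⊞∑ (tabulate λ j → val (⟦ Φ ⟧ (crossRatio C (C′ j) (xⱼ j) (x₀ j)))) 1#
      where
      open Function.Equivalence using (from)
      common : ∀ {m} (C : Circuit) (D : Cocircuit) (x : Fin m → Fin n) → Enumerates (value C ∩ value D) x →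
               ∀ (C′ : Circuit) i → x i ∈ value C′ ∩ value D → Elem (value C ∩ value C′)
      common C D x (_ , C∩D) C′ i xᵢ∈C′∩D = x i ,
        [ x∈p∩q⁺ ( p∩q⊆p (value C) (value D) (from (C∩D (x i)) (i , ≡.refl))
                 , p∩q⊆p (value C′) (value D) xᵢ∈C′∩D ) ]

    -- (𝓢) for strong, (𝓦) for weak.
    Condition : Strength → Set (c ⊔ ℓ ⊔ h)
    Condition strong = ∀ k → 2 ≤ k → ConditionAt k
    Condition weak   = ∀ k → 2 ≤ k → k ≤ 2 → ConditionAt k

  Homs : Strength → CrossRatioGroup M → Setoid (c ⊔ ℓ ⊔ h) ℓ
  Homs s T = record
    { Carrier = ∃ λ (Φ : TutteHomomorphism T) → Condition Φ s
    ; _≈_     = _≗ᴴ_ on proj₁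
    ; isEquivalence = record
      { refl  = λ _ → ℍ*.refl
      ; sym   = λ Φ≈Ψ t → ℍ*.sym (Φ≈Ψ t)
      ; trans = λ Φ≈Ψ Ψ≈Ω t → ℍ*.trans (Φ≈Ψ t) (Ψ≈Ω t)
      }
    }

  signatures : TutteHomomorphism extendedTutteGroup → Signatures
  signatures Φ = (λ C x → ⟦ Φ ⟧ (C ⟨ x ⟩)) , (λ D y → τ* (⟦ Φ ⟧ (D ⟨ y ⟩*)))

  module _ (Φ : TutteHomomorphism extendedTutteGroup) where
    private
      module Φ = TutteHomomorphism Φ

      restrict : ∀ {P} (P-isSubgroup : IsSubgroup 𝕋ᶜ {0ℓ} P) →
                 GroupHomomorphism (AbelianGroup.rawGroup (subgroup 𝕋ᶜ P-isSubgroup)) ℍ*.rawGroup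
      restrict _ = record
        { ⟦_⟧ = λ (t , _) → ⟦ Φ ⟧ t
        ; isGroupHomomorphism = record
          { isMonoidHomomorphism = record
            { isMagmaHomomorphism = record
              { isRelHomomorphism = record { cong = Φ.⟦⟧-cong }
              ; homo              = λ _ _ → Φ.homo _ _
              }
            ; ε-homo = Φ.ε-homo
            }
          ; ⁻¹-homo = λ _ → Φ.⁻¹-homo _
          }
        }

    restrictTutte : TutteHomomorphism tutteGroup
    restrictTutte = record { homomorphism = restrict (generated-isSubgroup 𝕋ᶜ TutteGenerator)
                           ; εᴹ-homo      = Φ.εᴹ-homo }

    restrictInner : TutteHomomorphism innerTutteGroup
    restrictInner = record { homomorphism = restrict (kernel-isSubgroup 𝕋ᶜ Degrees degree)
                           ; εᴹ-homo      = Φ.εᴹ-homo }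

{-# OPTIONS --safe #-}

-- Orthogonality at (C, D) with C ∩ D = {x₀, …, xₖ} is rescaled, through the relations
-- C_j(x_j) D(x_j) = ε C_j(x₀) D(x₀), to the condition on cross ratios; the auxiliary
-- circuits C_j exist as fundamental circuits, and |C ∩ D| = 1 is impossible.
--
-- Call a homomorphism from the extended Tutte group a scaling if it is of the form
-- C(x) ↦ η(x) b(C), D(y) ↦ η(y)⁻¹ l(D), ε ↦ 1. It factors through the degree, hence is
-- trivial on the inner Tutte group, and also on the Tutte group if η = 1. With values in
-- the extended Tutte group itself, there is a scaling σ such that t ↦ t / σ(t) is a
-- retraction onto the inner Tutte group: b and l come from base points of the circuits and
-- cocircuits, and η from paths in a spanning forest of E, whose vertices are joined if they
-- share a circuit or cocircuit. With η = 1 it is a retraction onto the Tutte group. Thus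
-- every homomorphism on the subgroup extends, and two homomorphisms agree on the subgroup
-- exactly if their ratio is a scaling.
module Submission where

open import Defs
open import Level using (0ℓ; _⊔_)
open import Algebra.Bundles using (AbelianGroup)
open import Algebra.Morphism.Bundles using (GroupHomomorphism)
import Algebra.Properties.AbelianGroup as AbelianGroupProperties
import Algebra.Properties.CommutativeSemigroup as CommutativeSemigroupProperties
import Algebra.Properties.Monoid.Mult as Mult
open import Data.Bool as Bool using (if_then_else_)
open import Data.Empty using (⊥-elim)
open import Data.Fin as Fin using (Fin)
import Data.Fin.Properties as Fin
open import Data.Fin.Subset
  using (Subset; inside; outside; _∈_; _∉_; _⊆_; _⊂_; _∩_; _∪_; ⁅_⁆; ∁; ∣_∣; _-_)
open import Data.Fin.Subset.Properties
open import Data.Integer as ℤ using (ℤ; +_; -[1+_]; 0ℤ; 1ℤ; _⊖_)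
import Data.Integer.Properties as ℤ
open import Data.Irrelevant using ([_])
open import Data.List
  using (List; []; _∷_; _++_; map; tabulate; allFin; cartesianProductWith; length; lookup)
open import Data.List.Membership.Propositional as List using ()
open import Data.List.Membership.Propositional.Properties
  using (∈-allFin; ∈-cartesianProductWith⁺; ∈-map⁺; ∈-++⁺ˡ; ∈-++⁺ʳ; ∈-tabulate⁺; ∈-lookup)
open import Data.List.Membership.Propositional.Properties.WithK using (unique∧set⇒bag)
open import Data.List.Properties using (length-map; length-tabulate; map-tabulate)
open import Data.List.Relation.Binary.BagAndSetEquality using (∼bag⇒↭)
open import Data.List.Relation.Binary.Permutation.Propositional as ↭ using (_↭_)
open import Data.List.Relation.Binary.Permutation.Propositional.Properties
  using (↭-length) renaming (map⁺ to ↭-map⁺)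
open import Data.List.Relation.Unary.All as All using (All; []; _∷_)
import Data.List.Relation.Unary.All.Properties as All
open import Data.List.Relation.Unary.AllPairs using ([]; _∷_)
open import Data.List.Relation.Unary.Any using (here; there; index)
open import Data.List.Relation.Unary.Any.Properties using (lookup-index)
open import Data.List.Relation.Unary.Unique.Propositional using (Unique)
import Data.List.Relation.Unary.Unique.Propositional.Properties as Unique
open import Data.Nat as ℕ using (ℕ; zero; suc; _≤_)
import Data.Nat.Properties as ℕ
open import Data.Product using (∃; ∃₂; ∃!; _×_; _,_; proj₁; proj₂)
open import Data.Refinement as Refinement using (Refinement; value; _,_)
open import Data.Sum using (_⊎_; inj₁; inj₂; [_,_]′)
open import Data.Vec using ([]; _∷_)
import Data.Vec.Properties as Vec
open import Function using (_∘_; id; mk⇔; Injective; Bijection; _⇔_)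
open import Relation.Binary using (Rel; Setoid; IsEquivalence)
open import Relation.Binary.PropositionalEquality as ≡ using (_≡_; _≢_)
import Relation.Binary.Reasoning.Setoid as SetoidReasoning
open import Relation.Nullary using (¬_; Dec; yes; no; contradiction; contradiction-irr; recompute)
open import Relation.Nullary.Decidable
  using (map′; ¬?; _×-dec_; _→-dec_; decidable-stable; dec-true; dec-false)
open import Relation.Unary using (Pred; Decidable)

-- Matroids: bases, circuits, and how circuits meet cocircuits.

x∉p⇒p⊂p∪⁅x⁆ : ∀ {n} {p : Subset n} {x} → x ∉ p → p ⊂ p ∪ ⁅ x ⁆
x∉p⇒p⊂p∪⁅x⁆ {p = p} {x} x∉p = p⊆p∪q ⁅ x ⁆ , x , q⊆p∪q p ⁅ x ⁆ (x∈⁅x⁆ x) , x∉p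

allSubset? : ∀ {n ℓ} {P : Pred (Subset n) ℓ} → Decidable P → Dec (∀ {p} → P p)
allSubset? {P = P} P? = map′ (λ ∄ {p} → decidable-stable (P? p) λ ¬P → ∄ (p , ¬P))
                             (λ { ∀P (_ , ¬P) → ¬P ∀P })
                             (¬? (anySubset? (¬? ∘ P?)))

module MatroidProperties {n} (M : Matroid n) where
  open Matroid M

  isBasis? : Decidable IsBasis
  isBasis? B = indep? B ×-dec allSubset? λ I → indep? I →-dec (B ⊆? I) →-dec (I ⊆? B)

  coindep? : Decidable Coindep
  coindep? I = anySubset? λ B → isBasis? B ×-dec (I ⊆? ∁ B)

  isCircuit? : Decidable IsCircuit
  isCircuit? C = ¬? (indep? C) ×-dec allSubset? λ I → (I ⊂? C) →-dec indep? I

  isCocircuit? : Decidable IsCocircuit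
  isCocircuit? D = ¬? (coindep? D) ×-dec allSubset? λ I → (I ⊂? D) →-dec coindep? I

  -- The proof inside a `Circuit` is irrelevant; decidability of `IsCircuit` allows it to be
  -- recomputed where it is needed.
  isCircuit : (C : Circuit) → IsCircuit (value C)
  isCircuit (C , [ p ]) = recompute (isCircuit? C) p

  isCocircuit : (D : Cocircuit) → IsCocircuit (value D)
  isCocircuit (D , [ p ]) = recompute (isCocircuit? D) p

  ∣indep∣≤∣basis∣ : ∀ {B I} → IsBasis B → Indep I → ∣ I ∣ ≤ ∣ B ∣
  ∣indep∣≤∣basis∣ {B} (Bᵢ , max) Iᵢ = ℕ.≮⇒≥ λ B<I →
    let x , _ , x∉B , B∪xᵢ = augment Bᵢ Iᵢ B<I
        _ , _ , x∈B∪x , _  = x∉p⇒p⊂p∪⁅x⁆ x∉B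
    in x∉B (max B∪xᵢ (p⊆p∪q ⁅ x ⁆) x∈B∪x)

  ∣basis∣≤⇒isBasis : ∀ {B I} → IsBasis B → Indep I → ∣ B ∣ ≤ ∣ I ∣ → IsBasis I
  ∣basis∣≤⇒isBasis {B} {I} Bᵇ Iᵢ B≤I = Iᵢ , λ {J} Jᵢ I⊆J {x} x∈J →
    decidable-stable (x ∈? I) λ x∉I → ℕ.<⇒≱ (p⊂q⇒∣p∣<∣q∣ (I⊆J , x , x∈J , x∉I))
      (ℕ.≤-trans (∣indep∣≤∣basis∣ Bᵇ Jᵢ) B≤I)

  -- Augmenting `I` from the fixed basis `B` adds only elements of `B` and stops at a set as large
  -- as `B`, which is then maximal. In `go`, the number `k` bounds how many elements `I` still
  -- lacks.
  extendToBasis : ∀ {B I} → IsBasis B → Indep I → ∃ λ B′ → IsBasis B′ × I ⊆ B′ × B′ ⊆ I ∪ B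
  extendToBasis {B} {I} Bᵇ Iᵢ = go ∣ B ∣ Iᵢ (ℕ.m≤m+n ∣ B ∣ _)
    where
    go : ∀ k {I} → Indep I → ∣ B ∣ ≤ k ℕ.+ ∣ I ∣ → ∃ λ B′ → IsBasis B′ × I ⊆ B′ × B′ ⊆ I ∪ B
    go zero {I} Iᵢ B≤ = I , ∣basis∣≤⇒isBasis Bᵇ Iᵢ B≤ , id , p⊆p∪q B
    go (suc k) {I} Iᵢ B≤ with ∣ B ∣ ℕ.≤? ∣ I ∣
    ... | yes B≤I = I , ∣basis∣≤⇒isBasis Bᵇ Iᵢ B≤I , id , p⊆p∪q B
    ... | no B≰I with x , x∈B , x∉I , I∪xᵢ ← augment Iᵢ (proj₁ Bᵇ) (ℕ.≰⇒> B≰I)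
      with B′ , B′ᵇ , I∪x⊆B′ , B′⊆ ← go k I∪xᵢ
        (ℕ.≤-trans B≤ (ℕ.≤-trans (ℕ.≤-reflexive (≡.sym (ℕ.+-suc k ∣ I ∣)))
          (ℕ.+-monoʳ-≤ k (p⊂q⇒∣p∣<∣q∣ (x∉p⇒p⊂p∪⁅x⁆ x∉I))))) =
      B′ , B′ᵇ , I∪x⊆B′ ∘ p⊆p∪q ⁅ x ⁆ , λ z∈B′ → x∈p∪q⁺
        ([ [ inj₁ , (λ z∈⁅x⁆ → inj₂ (≡.subst (_∈ B) (≡.sym (x∈⁅y⁆⇒x≡y x z∈⁅x⁆)) x∈B)) ]′
             ∘ x∈p∪q⁻ I ⁅ x ⁆
         , inj₂ ]′ (x∈p∪q⁻ (I ∪ ⁅ x ⁆) B (B′⊆ z∈B′)))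

  -- Passing to proper dependent subsets as long as there are any ends at a minimal dependent set;
  -- `k` bounds the size and hence the number of passes.
  circuitBelow : ∀ {S} → ¬ Indep S → ∃ λ C → IsCircuit C × C ⊆ S
  circuitBelow {S} = go ∣ S ∣ S ℕ.≤-refl
    where
    go : ∀ k S → ∣ S ∣ ≤ k → ¬ Indep S → ∃ λ C → IsCircuit C × C ⊆ S
    go k S S≤k ¬Sᵢ with anySubset? (λ I → (I ⊂? S) ×-dec ¬? (indep? I))
    ... | no ∄ = S , (¬Sᵢ , λ {I} I⊂S → decidable-stable (indep? I) λ ¬Iᵢ → ∄ (I , I⊂S , ¬Iᵢ)) , id
    ... | yes (I , I⊂S , ¬Iᵢ) with k
    ...   | zero  = contradiction (ℕ.<-≤-trans (p⊂q⇒∣p∣<∣q∣ I⊂S) S≤k) ℕ.n≮0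
    ...   | suc k = let C , Cᶜ , C⊆I = go k I (ℕ.s≤s⁻¹ (ℕ.<-≤-trans (p⊂q⇒∣p∣<∣q∣ I⊂S) S≤k)) ¬Iᵢ
                    in C , Cᶜ , proj₁ I⊂S ∘ C⊆I

  -- Otherwise some basis B avoids D - e, and extending C - e by elements of B gives a basis
  -- that contains C or avoids D.
  circuit∩cocircuit≢⁅e⁆ : ∀ {C D e} → IsCircuit C → IsCocircuit D → e ∈ C → e ∈ D →
                          ¬ (∀ {z} → z ∈ C → z ∈ D → z ≡ e)
  circuit∩cocircuit≢⁅e⁆ {C} {D} {e} (¬Cᵢ , C-min) (¬Dᵢ , D-min) e∈C e∈D only
    with B , Bᵇ , D-e⊆∁B ← D-min (x∈p⇒p-x⊂p e∈D)
    with B′ , B′ᵇ , C-e⊆B′ , B′⊆ ← extendToBasis Bᵇ (C-min (x∈p⇒p-x⊂p e∈C))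
    with e ∈? B′
  ... | yes e∈B′ = ¬Cᵢ (⊆-indep C⊆B′ (proj₁ B′ᵇ))
    where
    C⊆B′ : C ⊆ B′
    C⊆B′ {z} z∈C with z Fin.≟ e
    ... | yes ≡.refl = e∈B′
    ... | no z≢e     = C-e⊆B′ (x∈p∧x≢y⇒x∈p-y z∈C z≢e)
  ... | no e∉B′ = ¬Dᵢ (B′ , B′ᵇ , λ {z} z∈D → x∉p⇒x∈∁p λ z∈B′ →
    let z≢e : z ≢ e
        z≢e = λ { ≡.refl → e∉B′ z∈B′ }
    in [ (λ z∈C-e → z≢e (only (p─q⊆p C ⁅ e ⁆ z∈C-e) z∈D))
       , x∈∁p⇒x∉p (D-e⊆∁B (x∈p∧x≢y⇒x∈p-y z∈D z≢e)) ]′ (x∈p∪q⁻ _ B (B′⊆ z∈B′)))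

  -- A basis B with B ∩ D = {y} exists by minimality of D; the circuit is the
  -- fundamental circuit of x with respect to B.
  circuitThrough : ∀ (D : Cocircuit) {x y} → x ∈ value D → y ∈ value D → x ≢ y →
                   ∃ λ (C : Circuit) → value C ∩ value D ≡ ⁅ x ⁆ ∪ ⁅ y ⁆
  circuitThrough D′@(D , _) {x} {y} x∈D y∈D x≢y
    with Dᶜ@(¬Dᵢ , D-min) ← isCocircuit D′
    with B , Bᵇ@(Bᵢ , B-max) , D-y⊆∁B ← D-min (x∈p⇒p-x⊂p y∈D)
    with C , Cᶜ@(¬Cᵢ , _) , C⊆B∪x ← circuitBelow {B ∪ ⁅ x ⁆} (λ B∪xᵢ →
           x∈∁p⇒x∉p (D-y⊆∁B (x∈p∧x≢y⇒x∈p-y x∈D x≢y))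
             (B-max B∪xᵢ (p⊆p∪q ⁅ x ⁆) (q⊆p∪q B ⁅ x ⁆ (x∈⁅x⁆ x)))) =
      (C , [ Cᶜ ]) , ⊆-antisym C∩D⊆ ⊆C∩D
    where
    C∩D⇒ : ∀ {z} → z ∈ C → z ∈ D → z ≡ x ⊎ z ≡ y
    C∩D⇒ {z} z∈C z∈D with z Fin.≟ y
    ... | yes z≡y = inj₂ z≡y
    ... | no z≢y  = inj₁ ([ (λ z∈B → contradiction z∈B (x∈∁p⇒x∉p (D-y⊆∁B (x∈p∧x≢y⇒x∈p-y z∈D z≢y))))
                          , x∈⁅y⁆⇒x≡y x ]′ (x∈p∪q⁻ B ⁅ x ⁆ (C⊆B∪x z∈C)))
    x∈C : x ∈ C
    x∈C = decidable-stable (x ∈? C) λ x∉C → ¬Cᵢ (⊆-indep (λ z∈C →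
      [ id , (λ z∈⁅x⁆ → contradiction (≡.subst (_∈ C) (x∈⁅y⁆⇒x≡y x z∈⁅x⁆) z∈C) x∉C) ]′
        (x∈p∪q⁻ B ⁅ x ⁆ (C⊆B∪x z∈C))) Bᵢ)
    y∈C : y ∈ C
    y∈C = decidable-stable (y ∈? C) λ y∉C → circuit∩cocircuit≢⁅e⁆ Cᶜ Dᶜ x∈C x∈D λ z∈C z∈D →
      [ id , (λ z≡y → contradiction (≡.subst (_∈ C) z≡y z∈C) y∉C) ]′ (C∩D⇒ z∈C z∈D)
    C∩D⊆ : C ∩ D ⊆ ⁅ x ⁆ ∪ ⁅ y ⁆
    C∩D⊆ z∈C∩D with C∩D⇒ (p∩q⊆p C D z∈C∩D) (p∩q⊆q C D z∈C∩D)
    ... | inj₁ ≡.refl = x∈p∪q⁺ (inj₁ (x∈⁅x⁆ x))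
    ... | inj₂ ≡.refl = x∈p∪q⁺ (inj₂ (x∈⁅x⁆ y))
    ⊆C∩D : ⁅ x ⁆ ∪ ⁅ y ⁆ ⊆ C ∩ D
    ⊆C∩D z∈ with x∈p∪q⁻ ⁅ x ⁆ ⁅ y ⁆ z∈
    ... | inj₁ z∈⁅x⁆ = ≡.subst (_∈ C ∩ D) (≡.sym (x∈⁅y⁆⇒x≡y x z∈⁅x⁆)) (x∈p∩q⁺ (x∈C , x∈D))
    ... | inj₂ z∈⁅y⁆ = ≡.subst (_∈ C ∩ D) (≡.sym (x∈⁅y⁆⇒x≡y y z∈⁅y⁆)) (x∈p∩q⁺ (y∈C , y∈D))

-- Repetition-free enumerations of finite types.

-- Uniqueness makes a product over the list count every index once, and makes any two enumerations
-- permutations of each other.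
record Enumeration (A : Set) : Set where
  field
    list     : List A
    unique   : Unique list
    complete : ∀ a → a List.∈ list

finEnumeration : ∀ n → Enumeration (Fin n)
finEnumeration n = record { list = allFin n ; unique = Unique.allFin⁺ n ; complete = ∈-allFin }

subsetEnumeration : ∀ n → Enumeration (Subset n)
subsetEnumeration zero    = record
  { list = [] ∷ [] ; unique = [] ∷ [] ; complete = λ { [] → here ≡.refl } }
subsetEnumeration (suc n) = record
  { list     = cartesianProductWith _∷_ (inside ∷ outside ∷ []) list
  ; unique   = Unique.cartesianProductWith⁺ _∷_ Vec.∷-injective (((λ ()) ∷ []) ∷ [] ∷ []) unique
  ; complete = λ { (s ∷ p) → ∈-cartesianProductWith⁺ _∷_ (side∈ s) (complete p) }
  }
  where
  open Enumeration (subsetEnumeration n)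
  side∈ : ∀ s → s List.∈ inside ∷ outside ∷ []
  side∈ inside  = here ≡.refl
  side∈ outside = there (here ≡.refl)

refinementEnumeration : ∀ {A : Set} {P : Pred A 0ℓ} → Decidable P → Enumeration A →
                        Enumeration (Refinement A P)
refinementEnumeration {A} {P} P? enum = record
  { list = refine list ; unique = refine-unique unique ; complete = λ (a , [ p ]) → refine-∈ p (complete a) }
  where
  open Enumeration enum
  refine : List A → List (Refinement A P)
  refine []       = []
  refine (a ∷ as) with P? a
  ... | yes p = (a , [ p ]) ∷ refine as
  ... | no _  = refine as

  refine-All : ∀ {Q : Pred A 0ℓ} {as} → All Q as → All (Q ∘ value) (refine as)
  refine-All []                 = []
  refine-All {as = a ∷ _} (q ∷ qs) with P? a
  ... | yes _ = q ∷ refine-All qs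
  ... | no _  = refine-All qs

  refine-unique : ∀ {as} → Unique as → Unique (refine as)
  refine-unique []                  = []
  refine-unique {a ∷ _} (a≢ ∷ as!) with P? a
  ... | yes _ = All.map (λ a≢b a≡b → a≢b (≡.cong value a≡b)) (refine-All a≢) ∷ refine-unique as!
  ... | no _  = refine-unique as!

  -- `refine` stores the proof found by `P?` rather than `p`; proof irrelevance identifies the two
  -- elements.
  refine-∈ : ∀ {a as} .(p : P a) → a List.∈ as → (a , [ p ]) List.∈ refine as
  refine-∈ {a} p (here ≡.refl) with P? a
  ... | yes _ = here ≡.refl
  ... | no ¬p = contradiction-irr p ¬p
  refine-∈ {as = b ∷ _} p (there a∈) with P? b
  ... | yes _ = there (refine-∈ p a∈)
  ... | no _  = refine-∈ p a∈

-- Integer powers and finite products in abelian groups.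

module _ {c ℓ} (G : AbelianGroup c ℓ) where
  open AbelianGroup G renaming (_-_ to _//_)
  open AbelianGroupProperties G
  open CommutativeSemigroupProperties commutativeSemigroup using (interchange)
  open Mult monoid using () renaming (_×_ to _·ⁿ_; ×-homo-+ to ·ⁿ-homo-+)
  open SetoidReasoning setoid

  infixr 8 _^ᶻ_
  _^ᶻ_ : Carrier → ℤ → Carrier
  x ^ᶻ (+ n)    = n ·ⁿ x
  x ^ᶻ -[1+ n ] = (suc n ·ⁿ x) ⁻¹

  -- This is the mixed-sign case of the exponent law, as a sum of integers of opposite sign computes
  -- to `⊖`.
  ^ᶻ-⊖ : ∀ x m n → x ^ᶻ (m ⊖ n) ≈ (m ·ⁿ x) // (n ·ⁿ x)
  ^ᶻ-⊖ x m zero            = sym (trans (∙-congˡ ε⁻¹≈ε) (identityʳ _))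
  ^ᶻ-⊖ x zero (suc n)      = sym (identityˡ _)
  ^ᶻ-⊖ x (suc m) (suc n)   = begin
    x ^ᶻ (suc m ⊖ suc n)                   ≡⟨ ≡.cong (x ^ᶻ_) (ℤ.[1+m]⊖[1+n]≡m⊖n m n) ⟩
    x ^ᶻ (m ⊖ n)                           ≈⟨ ^ᶻ-⊖ x m n ⟩
    (m ·ⁿ x) // (n ·ⁿ x)                   ≈⟨ identityˡ _ ⟨
    ε ∙ ((m ·ⁿ x) // (n ·ⁿ x))             ≈⟨ ∙-congʳ (inverseʳ x) ⟨
    (x // x) ∙ ((m ·ⁿ x) // (n ·ⁿ x))       ≈⟨ interchange _ _ _ _ ⟩
    (suc m ·ⁿ x) ∙ (x ⁻¹ ∙ (n ·ⁿ x) ⁻¹)    ≈⟨ ∙-congˡ (⁻¹-∙-comm _ _) ⟩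
    (suc m ·ⁿ x) // (suc n ·ⁿ x)           ∎

  ^ᶻ-+ : ∀ x i j → x ^ᶻ (i ℤ.+ j) ≈ x ^ᶻ i ∙ x ^ᶻ j
  ^ᶻ-+ x (+ m)    (+ n)    = ·ⁿ-homo-+ x m n
  ^ᶻ-+ x (+ m)    -[1+ n ] = ^ᶻ-⊖ x m (suc n)
  ^ᶻ-+ x -[1+ m ] (+ n)    = trans (^ᶻ-⊖ x n (suc m)) (comm _ _)
  ^ᶻ-+ x -[1+ m ] -[1+ n ] = begin
    (suc (suc (m ℕ.+ n)) ·ⁿ x) ⁻¹         ≡⟨ ≡.cong (λ k → (suc k ·ⁿ x) ⁻¹) (ℕ.+-suc m n) ⟨
    (suc (m ℕ.+ suc n) ·ⁿ x) ⁻¹           ≈⟨ ⁻¹-cong (·ⁿ-homo-+ x (suc m) (suc n)) ⟩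
    ((suc m ·ⁿ x) ∙ (suc n ·ⁿ x)) ⁻¹      ≈⟨ ⁻¹-∙-comm _ _ ⟨
    (suc m ·ⁿ x) ⁻¹ ∙ (suc n ·ⁿ x) ⁻¹     ∎

  -- The image of the unit is idempotent, hence the unit, and inverses are unique, so compatibility
  -- with products is enough.
  ∙-homo⇒homomorphism : ∀ {a ℓ′} (H : AbelianGroup a ℓ′) (let module H = AbelianGroup H)
    (f : H.Carrier → Carrier) → (∀ {x y} → x H.≈ y → f x ≈ f y) →
    (∀ x y → f (x H.∙ y) ≈ f x ∙ f y) → GroupHomomorphism H.rawGroup rawGroup
  ∙-homo⇒homomorphism H f f-cong f-∙ = record
    { ⟦_⟧ = f
    ; isGroupHomomorphism = record
      { isMonoidHomomorphism = record
        { isMagmaHomomorphism = record { isRelHomomorphism = record { cong = f-cong } ; homo = f-∙ }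
        ; ε-homo = f-ε
        }
      ; ⁻¹-homo = λ x → inverseˡ-unique _ _
          (trans (sym (f-∙ _ _)) (trans (f-cong (H.inverseˡ x)) f-ε))
      }
    }
    where
    module H = AbelianGroup H
    f-ε : f H.ε ≈ ε
    f-ε = identityˡ-unique (f H.ε) (f H.ε) (trans (sym (f-∙ _ _)) (f-cong (H.identityˡ H.ε)))

  module _ {A : Set} (b : A → Carrier) where

    -- For an enumeration `as`, this is the homomorphism from the free abelian group on `A` that
    -- extends `b`, evaluated at the exponent vector `f`.
    ∏^ : List A → (A → ℤ) → Carrier
    ∏^ []       f = ε
    ∏^ (a ∷ as) f = b a ^ᶻ f a ∙ ∏^ as f

    ∏^-cong : ∀ as {f g} → (∀ a → f a ≡ g a) → ∏^ as f ≈ ∏^ as g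
    ∏^-cong []       f≗g = refl
    ∏^-cong (a ∷ as) f≗g = ∙-cong (reflexive (≡.cong (b a ^ᶻ_) (f≗g a))) (∏^-cong as f≗g)

    ∏^-+ : ∀ as f g → ∏^ as (λ a → f a ℤ.+ g a) ≈ ∏^ as f ∙ ∏^ as g
    ∏^-+ []       f g = sym (identityˡ ε)
    ∏^-+ (a ∷ as) f g =
      trans (∙-cong (^ᶻ-+ (b a) (f a) (g a)) (∏^-+ as f g)) (interchange _ _ _ _)

    ∏^-0 : ∀ {as f} → All (λ a → f a ≡ 0ℤ) as → ∏^ as f ≈ ε
    ∏^-0 []                             = refl
    ∏^-0 {a ∷ _} (fa≡0 ∷ f≡0) =
      trans (∙-cong (reflexive (≡.cong (b a ^ᶻ_) fa≡0)) (∏^-0 f≡0)) (identityˡ ε)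

    -- `f` is described by its values so that both `𝟙ᴱ` and `𝟙ˢ` fit. As the list has no
    -- repetitions, a single factor survives.
    ∏^-indicator : ∀ {as f a} → Unique as → a List.∈ as →
                   f a ≡ 1ℤ → (∀ {a′} → a ≢ a′ → f a′ ≡ 0ℤ) → ∏^ as f ≈ b a
    ∏^-indicator {a ∷ _} (a≢as ∷ _) (here ≡.refl) fa≡1 f≡0 =
      trans (∙-cong (trans (reflexive (≡.cong (b a ^ᶻ_) fa≡1)) (identityʳ _)) (∏^-0 (All.map f≡0 a≢as)))
            (identityʳ _)
    ∏^-indicator {a ∷ _} (a≢as ∷ as!) (there a∈as) fa≡1 f≡0 =
      trans (∙-cong (reflexive (≡.cong (b a ^ᶻ_) (f≡0 λ { ≡.refl → All.lookup a≢as a∈as ≡.refl })))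
                    (∏^-indicator as! a∈as fa≡1 f≡0))
            (identityˡ _)

    ∏^-neg : ∀ as f → ∏^ as (λ a → ℤ.- f a) ≈ (∏^ as f) ⁻¹
    ∏^-neg as f = inverseˡ-unique _ _ (trans (sym (∏^-+ as _ f))
      (∏^-0 {as} (All.universal (λ a → ℤ.+-inverseˡ (f a)) as)))

-- Homomorphisms and subgroups.

Hom : ∀ {a ℓ b ℓ′} → AbelianGroup a ℓ → AbelianGroup b ℓ′ → Set _
Hom G H = GroupHomomorphism (AbelianGroup.rawGroup G) (AbelianGroup.rawGroup H)

identityHom : ∀ {a ℓ} (G : AbelianGroup a ℓ) → Hom G G
identityHom G = ∙-homo⇒homomorphism G G id id (λ _ _ → AbelianGroup.refl G)

module _ {a ℓ b ℓ′} (H : AbelianGroup a ℓ) (G : AbelianGroup b ℓ′) where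
  private module H = AbelianGroup H
  open AbelianGroup G renaming (_-_ to _//_)
  open AbelianGroupProperties G
  open CommutativeSemigroupProperties commutativeSemigroup using (interchange)

  quotient : Hom H G → Hom H G → Hom H G
  quotient φ ψ = ∙-homo⇒homomorphism G H (λ x → φ.⟦ x ⟧ // ψ.⟦ x ⟧)
    (λ x≈y → ∙-cong (φ.⟦⟧-cong x≈y) (⁻¹-cong (ψ.⟦⟧-cong x≈y)))
    (λ x y → trans (∙-cong (φ.homo x y) (trans (⁻¹-cong (ψ.homo x y)) (sym (⁻¹-∙-comm _ _))))
                   (interchange _ _ _ _))
    where
    module φ = GroupHomomorphism φ
    module ψ = GroupHomomorphism ψ

  equalizer-isSubgroup : (φ ψ : Hom H G) → let open GroupHomomorphism in
                         IsSubgroup H (λ x → ⟦_⟧ φ x ≈ ⟦_⟧ ψ x)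
  equalizer-isSubgroup φ ψ = record
    { resp = λ x≈y p → trans (φ.⟦⟧-cong (H.sym x≈y)) (trans p (ψ.⟦⟧-cong x≈y))
    ; ε∈   = trans φ.ε-homo (sym ψ.ε-homo)
    ; ∙∈   = λ p q → trans (φ.homo _ _) (trans (∙-cong p q) (sym (ψ.homo _ _)))
    ; ⁻¹∈  = λ p → trans (φ.⁻¹-homo _) (trans (⁻¹-cong p) (sym (ψ.⁻¹-homo _)))
    }
    where
    module φ = GroupHomomorphism φ
    module ψ = GroupHomomorphism ψ

  preimage-isSubgroup : ∀ {p} {P : Pred Carrier p} (φ : Hom H G) → IsSubgroup G P →
                        IsSubgroup H (P ∘ GroupHomomorphism.⟦_⟧ φ)
  preimage-isSubgroup φ P-isSubgroup = record
    { resp = λ x≈y → P.resp (φ.⟦⟧-cong x≈y)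
    ; ε∈   = P.resp (sym φ.ε-homo) P.ε∈
    ; ∙∈   = λ p q → P.resp (sym (φ.homo _ _)) (P.∙∈ p q)
    ; ⁻¹∈  = λ p → P.resp (sym (φ.⁻¹-homo _)) (P.⁻¹∈ p)
    }
    where
    module φ = GroupHomomorphism φ
    module P = IsSubgroup P-isSubgroup

generated-⊆ : ∀ {a ℓ s p} (G : AbelianGroup a ℓ) {S : Pred (AbelianGroup.Carrier G) s}
              {P : Pred (AbelianGroup.Carrier G) p} → IsSubgroup G P →
              (∀ {x} → S x → P x) → ∀ {x} → Generated G S x → P x
generated-⊆ G {S} {P} P-isSubgroup S⊆P = go
  where
  module P = IsSubgroup P-isSubgroup
  go : ∀ {x} → Generated G S x → P x
  go (gen s)    = S⊆P s
  go (resp e x) = P.resp e (go x)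
  go ε∈         = P.ε∈
  go (∙∈ x y)   = P.∙∈ (go x) (go y)
  go (⁻¹∈ x)    = P.⁻¹∈ (go x)

module _ {X : Set} {R : Word X → Word X → Set} where
  open Presentation R

  -- With an equalizer for `P`, equality of two homomorphisms is reduced to the generators; with a
  -- preimage, so is membership of all values in a subgroup.
  ∈-words : ∀ {p} {P : Pred (Word X) p} → IsSubgroup presented P → (∀ x → P (gen x)) → ∀ w → P w
  ∈-words P-isSubgroup gen∈ = go
    where
    module P = IsSubgroup P-isSubgroup
    go : ∀ w → _
    go (gen x) = gen∈ x
    go 1ʷ      = P.ε∈
    go (u · v) = P.∙∈ (go u) (go v)
    go (u ⁻)   = P.⁻¹∈ (go u)

-- Cancellation identities and spanning forests.

module _ {c ℓ} (G : AbelianGroup c ℓ) where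
  open AbelianGroup G renaming (_-_ to _//_)
  open AbelianGroupProperties G
  open CommutativeSemigroupProperties commutativeSemigroup
  open SetoidReasoning setoid

  telescope : ∀ a b d → (a // b) ∙ (b // d) ≈ a // d
  telescope a b d = begin
    (a // b) ∙ (b // d)      ≈⟨ assoc _ _ _ ⟩
    a ∙ (b ⁻¹ ∙ (b // d))    ≈⟨ ∙-congˡ (assoc _ _ _) ⟨
    a ∙ ((b ⁻¹ ∙ b) // d)    ≈⟨ ∙-congˡ (trans (∙-congʳ (inverseˡ b)) (identityˡ _)) ⟩
    a // d                   ∎

  -- Used to balance degrees: `a` and `b` come from the base point, `r` and `s` from the common
  -- root, and both pairs cancel.
  cancel-telescope : ∀ {a b r s v} d → a ∙ b ≈ ε → r ∙ s ≈ ε → (d ∙ r) ∙ ((a ∙ v) ∙ (b ∙ s)) ≈ d ∙ v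
  cancel-telescope {a} {b} {r} {s} {v} d ab≈ε rs≈ε = begin
    (d ∙ r) ∙ ((a ∙ v) ∙ (b ∙ s))  ≈⟨ ∙-congˡ (interchange a v b s) ⟩
    (d ∙ r) ∙ ((a ∙ b) ∙ (v ∙ s))  ≈⟨ ∙-congˡ (trans (∙-congʳ ab≈ε) (identityˡ _)) ⟩
    (d ∙ r) ∙ (v ∙ s)              ≈⟨ interchange d r v s ⟩
    (d ∙ v) ∙ (r ∙ s)              ≈⟨ trans (∙-congˡ rs≈ε) (identityʳ _) ⟩
    d ∙ v                          ∎

-- A spanning forest, grown one linked set at a time: when a set meets several trees,
-- these are all re-rooted at the root of one of its elements.
module Forest {a ℓ b ℓ′} (T : AbelianGroup a ℓ) (D : AbelianGroup b ℓ′) (deg : Hom T D)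
              {n} (u : Fin n → AbelianGroup.Carrier D) where
  private module T = AbelianGroup T
  open AbelianGroup D renaming (_-_ to _//_)
  open AbelianGroupProperties D
  open GroupHomomorphism deg

  Joins : Fin n → Fin n → Set _
  Joins x y = ∃ λ t → ⟦ t ⟧ ≈ u x // u y

  Linked : Subset n → Set _
  Linked S = ∀ {x y} → x ∈ S → y ∈ S → Joins x y

  joins-refl : ∀ {x} → Joins x x
  joins-refl = T.ε , trans ε-homo (sym (inverseʳ _))

  joins-sym : ∀ {x y} → Joins x y → Joins y x
  joins-sym (t , t≈) = t T.⁻¹ , trans (⁻¹-homo t) (trans (⁻¹-cong t≈) (⁻¹-anti-homo‿- _ _))

  joins-trans : ∀ {x y z} → Joins x y → Joins y z → Joins x z
  joins-trans (t , t≈) (s , s≈) = t T.∙ s , trans (homo t s) (trans (∙-cong t≈ s≈) (telescope D _ _ _))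

  -- A forest is recorded by the root of each element's tree and a path to it; each linked set lies
  -- inside one tree.
  record Rooting (L : List (Subset n)) : Set (a ⊔ ℓ′) where
    field
      root     : Fin n → Fin n
      path     : ∀ e → Joins e (root e)
      constant : ∀ {S x y} → S List.∈ L → x ∈ S → y ∈ S → root x ≡ root y

  rooting : ∀ {L} → All Linked L → Rooting L
  rooting []                = record { root = id ; path = λ _ → joins-refl ; constant = λ () }
  rooting {S ∷ L} (link ∷ links) with nonempty? S
  ... | no empty = record
    { root     = root
    ; path     = path
    ; constant = λ { (here ≡.refl) x∈S _ → contradiction (_ , x∈S) empty ; (there S∈L) → constant S∈L }
    }
    where
    open Rooting (rooting links)
  ... | yes (s , s∈S) = record
    { root     = newRoot ∘ root
    ; path     = λ e → joins-trans (path e) (reroot e)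
    ; constant = λ { (here ≡.refl) x∈S y∈S → ≡.trans (newRoot-S x∈S) (≡.sym (newRoot-S y∈S))
                   ; (there S∈L) x∈ y∈ → ≡.cong newRoot (constant S∈L x∈ y∈) }
    }
    where
    open Rooting (rooting links)
    meetsS? : ∀ r → Dec (∃ λ x → x ∈ S × root x ≡ r)
    meetsS? r = Fin.any? λ x → (x ∈? S) ×-dec (root x Fin.≟ r)
    newRoot : Fin n → Fin n
    newRoot r with meetsS? r
    ... | yes _ = root s
    ... | no _  = r
    reroot : ∀ e → Joins (root e) (newRoot (root e))
    reroot e with meetsS? (root e)
    -- The old root is joined back to `x`, across `S` to `s`, and on to the root of `s`.
    ... | yes (x , x∈S , rx≡re) = ≡.subst (λ r → Joins r (root s)) rx≡re
            (joins-trans (joins-sym (path x)) (joins-trans (link x∈S s∈S) (path s)))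
    ... | no _ = joins-refl
    newRoot-S : ∀ {x} → x ∈ S → newRoot (root x) ≡ root s
    newRoot-S {x} x∈S with meetsS? (root x)
    ... | yes _ = ≡.refl
    ... | no ∄  = contradiction (x , x∈S , ≡.refl) ∄

-- Degrees, scalings, and retractions onto the Tutte group and the inner Tutte group.

module TutteProperties {n} (M : Matroid n) where
  open Matroid M
  open MatroidProperties M
  open Tutte M
  private
    module 𝕋ᶜ = AbelianGroup 𝕋ᶜ
    module 𝔻 = AbelianGroup Degrees

  circuits : Enumeration Circuit
  circuits = refinementEnumeration isCircuit? (subsetEnumeration n)

  cocircuits : Enumeration Cocircuit
  cocircuits = refinementEnumeration isCocircuit? (subsetEnumeration n)

  degᴱ : Fin n → 𝔻.Carrier
  degᴱ x = 𝟙ᴱ x , (λ _ → 0ℤ) , (λ _ → 0ℤ)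

  degᶜ : Circuit → 𝔻.Carrier
  degᶜ C = (λ _ → 0ℤ) , 𝟙ˢ C , (λ _ → 0ℤ)

  degᶜ* : Cocircuit → 𝔻.Carrier
  degᶜ* D = (λ _ → 0ℤ) , (λ _ → 0ℤ) , 𝟙ˢ D

  degree-circuit : ∀ C x → degree₀ (C at x) 𝔻.≈ degᴱ (value x) 𝔻.∙ degᶜ C
  degree-circuit C x =
    (λ _ → ≡.sym (ℤ.+-identityʳ _)) , (λ _ → ≡.sym (ℤ.+-identityˡ _)) , (λ _ → ≡.refl)

  degree-cocircuit : ∀ D y → degree₀ (D at* y) 𝔻.≈ degᴱ (value y) 𝔻.⁻¹ 𝔻.∙ degᶜ* D
  degree-cocircuit D y =
    (λ _ → ≡.sym (ℤ.+-identityʳ _)) , (λ _ → ≡.refl) , (λ _ → ≡.sym (ℤ.+-identityˡ _))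

  module _ (x : Fin n) where
    𝟙ᴱ-self : 𝟙ᴱ x x ≡ 1ℤ
    𝟙ᴱ-self = ≡.cong (if_then 1ℤ else 0ℤ) (dec-true (x Fin.≟ x) ≡.refl)

    𝟙ᴱ-other : ∀ {y} → x ≢ y → 𝟙ᴱ x y ≡ 0ℤ
    𝟙ᴱ-other {y} x≢y = ≡.cong (if_then 1ℤ else 0ℤ) (dec-false (x Fin.≟ y) x≢y)

  module _ {P : Pred (Subset n) 0ℓ} (A : Refinement (Subset n) P) where
    𝟙ˢ-self : 𝟙ˢ A A ≡ 1ℤ
    𝟙ˢ-self = ≡.cong (if_then 1ℤ else 0ℤ) (dec-true (Vec.≡-dec Bool._≟_ (value A) (value A)) ≡.refl)

    𝟙ˢ-other : ∀ {B} → A ≢ B → 𝟙ˢ A B ≡ 0ℤ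
    𝟙ˢ-other {B} A≢B = ≡.cong (if_then 1ℤ else 0ℤ)
      (dec-false (Vec.≡-dec Bool._≟_ (value A) (value B)) λ { ≡.refl → A≢B ≡.refl })

  module Scaling {c ℓ} (G : AbelianGroup c ℓ) (h : Fin n → AbelianGroup.Carrier G)
                 (b : Circuit → AbelianGroup.Carrier G) (l : Cocircuit → AbelianGroup.Carrier G) where
    open AbelianGroup G renaming (_-_ to _//_)
    open AbelianGroupProperties G
    open CommutativeSemigroupProperties commutativeSemigroup using (interchange)
    module E  = Enumeration (finEnumeration n)
    module 𝓒  = Enumeration circuits
    module 𝓒* = Enumeration cocircuits

    -- `Degrees` is free abelian on elements, circuits and cocircuits; its basis vectors are sent to
    -- the values of `h`, `b` and `l`.
    potential : Hom Degrees G
    potential = ∙-homo⇒homomorphism G Degrees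
      (λ (f , g , k) → ∏^ G h E.list f ∙ (∏^ G b 𝓒.list g ∙ ∏^ G l 𝓒*.list k))
      (λ (f≗ , g≗ , k≗) → ∙-cong (∏^-cong G h E.list f≗)
        (∙-cong (∏^-cong G b 𝓒.list g≗) (∏^-cong G l 𝓒*.list k≗)))
      (λ (f , g , k) (f′ , g′ , k′) → trans
        (∙-cong (∏^-+ G h E.list f f′)
          (trans (∙-cong (∏^-+ G b 𝓒.list g g′) (∏^-+ G l 𝓒*.list k k′)) (interchange _ _ _ _)))
        (interchange _ _ _ _))
    private module potential = GroupHomomorphism potential

    scaling : Hom 𝕋ᶜ G
    scaling = ∙-homo⇒homomorphism G 𝕋ᶜ (λ t → potential.⟦ degree.⟦ t ⟧ ⟧)
      (λ {s} {t} s≈t → potential.⟦⟧-cong {degree.⟦ s ⟧} {degree.⟦ t ⟧} (degree.⟦⟧-cong s≈t))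
      (λ s t → potential.homo degree.⟦ s ⟧ degree.⟦ t ⟧)
      where module degree = GroupHomomorphism degree
    open GroupHomomorphism scaling using (⟦_⟧)

    private
      ∏^-zero : ∀ {A : Set} (b : A → Carrier) as → ∏^ G b as (λ _ → 0ℤ) ≈ ε
      ∏^-zero b as = ∏^-0 G b (All.universal (λ _ → ≡.refl) as)

      ∏^-𝟙ᴱ : ∀ x → ∏^ G h E.list (𝟙ᴱ x) ≈ h x
      ∏^-𝟙ᴱ x = ∏^-indicator G h E.unique (E.complete x) (𝟙ᴱ-self x) (𝟙ᴱ-other x)

    scaling-ε : ⟦ ε₀ ⟧ ≈ ε
    scaling-ε = potential.ε-homo

    scaling-circuit : ∀ C x → ⟦ C ⟨ x ⟩ ⟧ ≈ h (value x) ∙ b C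
    scaling-circuit C x = ∙-cong (∏^-𝟙ᴱ (value x)) (trans
      (∙-cong (∏^-indicator G b 𝓒.unique (𝓒.complete C) (𝟙ˢ-self C) (𝟙ˢ-other C)) (∏^-zero l 𝓒*.list))
      (identityʳ _))

    scaling-cocircuit : ∀ D y → ⟦ D ⟨ y ⟩* ⟧ ≈ h (value y) ⁻¹ ∙ l D
    scaling-cocircuit D y = ∙-cong (trans (∏^-neg G h E.list _) (⁻¹-cong (∏^-𝟙ᴱ (value y)))) (trans
      (∙-cong (∏^-zero b 𝓒.list) (∏^-indicator G l 𝓒*.unique (𝓒*.complete D) (𝟙ˢ-self D) (𝟙ˢ-other D)))
      (identityˡ _))

    scaling-inner : ∀ {t} → InInner t → ⟦ t ⟧ ≈ ε
    scaling-inner {t} t∈ =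
      trans (potential.⟦⟧-cong {GroupHomomorphism.⟦_⟧ degree t} {𝔻.ε} t∈) potential.ε-homo

    -- Apart from `ε₀`, the generators of the Tutte group are ratios within one circuit or
    -- cocircuit, where `b C` or `l D` cancels and only the trivial `h` remains.
    scaling-tutte : (∀ e → h e ≈ ε) → ∀ {t} → InTutte t → ⟦ t ⟧ ≈ ε
    scaling-tutte h≈ε = generated-⊆ 𝕋ᶜ (kernel-isSubgroup 𝕋ᶜ G scaling) λ where
        ε-gen                 → scaling-ε
        (circuit-gen C x y)   → trans (scaling.homo (C ⟨ x ⟩) (C ⟨ y ⟩ ⁻))
          (trans (∙-congˡ (scaling.⁻¹-homo (C ⟨ y ⟩))) (x≈y⇒x∙y⁻¹≈ε
            (trans (scaling-circuit C x) (trans (∙-congʳ (trans (h≈ε _) (sym (h≈ε _)))) (sym (scaling-circuit C y))))))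
        (cocircuit-gen D x y) → trans (scaling.homo (D ⟨ x ⟩*) (D ⟨ y ⟩* ⁻))
          (trans (∙-congˡ (scaling.⁻¹-homo (D ⟨ y ⟩*))) (x≈y⇒x∙y⁻¹≈ε
            (trans (scaling-cocircuit D x)
              (trans (∙-congʳ (⁻¹-cong (trans (h≈ε _) (sym (h≈ε _))))) (sym (scaling-cocircuit D y))))))
      where module scaling = GroupHomomorphism scaling

  -- For the retraction `t ↦ t · σ t ⁻`, the last field puts its values into `P`, and `σ-trivial`
  -- makes it fix `P`.
  record Splitting {P : Pred (Word Generator) 0ℓ} (P-isSubgroup : IsSubgroup 𝕋ᶜ P) : Set where
    field
      η : Fin n → Word Generator
      b : Circuit → Word Generator
      l : Cocircuit → Word Generator
    open Scaling 𝕋ᶜ η b l public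
    open GroupHomomorphism scaling using () renaming (⟦_⟧ to σ) public
    field
      σ-trivial  : ∀ {t} → P t → σ t 𝕋ᶜ.≈ 1ʷ
      remainder∈ : ∀ t → P (t · σ t ⁻)

  module _ {S : Subset n} (f : Elem S → Word Generator) where

    -- The default `1ʷ` occurs only for the empty set, which carries no generator to be scaled.
    atBasepoint : Word Generator
    atBasepoint with nonempty? S
    ... | yes (x , x∈S) = f (x , [ x∈S ])
    ... | no _          = 1ʷ

    atBasepoint-∃ : Elem S → ∃ λ x → atBasepoint ≡ f x
    atBasepoint-∃ (x , [ x∈S ]) with nonempty? S
    ... | yes (y , y∈S) = (y , [ y∈S ]) , ≡.refl
    ... | no empty      = contradiction-irr (x , x∈S) empty

  -- `b` and `l` are chosen such that the scaling fixes the generator at the base point of each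
  -- circuit and cocircuit. The remainder at `x` thus compares `x` with a base point `y`, as in the
  -- hypotheses.
  module BasepointSplitting
    {P : Pred (Word Generator) 0ℓ} (P-isSubgroup : IsSubgroup 𝕋ᶜ P) (w : Fin n → Word Generator)
    (ε₀∈ : P ε₀)
    (circuit∈   : ∀ C x y → P (C ⟨ x ⟩ · (w (value x) · (C ⟨ y ⟩ · w (value y) ⁻)) ⁻))
    (cocircuit∈ : ∀ D x y → P (D ⟨ x ⟩* · (w (value x) ⁻ · (D ⟨ y ⟩* · w (value y))) ⁻))
    where
    private module P = IsSubgroup P-isSubgroup
    open AbelianGroupProperties 𝕋ᶜ using (ε⁻¹≈ε)

    b : Circuit → Word Generator
    b C = atBasepoint λ x → C ⟨ x ⟩ · w (value x) ⁻

    l : Cocircuit → Word Generator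
    l D = atBasepoint λ y → D ⟨ y ⟩* · w (value y)

    private
      open Scaling 𝕋ᶜ w b l
      module σ = GroupHomomorphism scaling

      divide : ∀ {t s s′} → s 𝕋ᶜ.≈ s′ → P (t · s′ ⁻) → P (t · s ⁻)
      divide s≈s′ = P.resp (𝕋ᶜ.∙-congˡ (𝕋ᶜ.⁻¹-cong (𝕋ᶜ.sym s≈s′)))

    generator-remainder∈ : ∀ g → P (gen g · σ.⟦ gen g ⟧ ⁻)
    generator-remainder∈ epsilon = divide scaling-ε
      (P.resp (𝕋ᶜ.sym (𝕋ᶜ.trans (𝕋ᶜ.∙-congˡ ε⁻¹≈ε) (𝕋ᶜ.identityʳ ε₀))) ε₀∈)
    generator-remainder∈ (C at x)
      with y , eq ← atBasepoint-∃ (λ x → C ⟨ x ⟩ · w (value x) ⁻) x =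
      divide (𝕋ᶜ.trans (scaling-circuit C x) (𝕋ᶜ.∙-congˡ (𝕋ᶜ.reflexive eq))) (circuit∈ C x y)
    generator-remainder∈ (D at* x)
      with y , eq ← atBasepoint-∃ (λ y → D ⟨ y ⟩* · w (value y)) x =
      divide (𝕋ᶜ.trans (scaling-cocircuit D x) (𝕋ᶜ.∙-congˡ (𝕋ᶜ.reflexive eq))) (cocircuit∈ D x y)

    splitting : (∀ {t} → P t → σ.⟦ t ⟧ 𝕋ᶜ.≈ 1ʷ) → Splitting P-isSubgroup
    splitting trivial = record
      { η = w ; b = b ; l = l
      ; σ-trivial  = λ {t} → trivial {t}
      -- The remainder is a homomorphism in `t`, so its membership in `P` is checked on generators.
      ; remainder∈ = ∈-words (preimage-isSubgroup 𝕋ᶜ 𝕋ᶜ (quotient 𝕋ᶜ 𝕋ᶜ (identityHom 𝕋ᶜ) scaling) P-isSubgroup)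
          generator-remainder∈
      }

  tutte-isSubgroup : IsSubgroup 𝕋ᶜ InTutte
  tutte-isSubgroup = generated-isSubgroup 𝕋ᶜ TutteGenerator

  inner-isSubgroup : IsSubgroup 𝕋ᶜ InInner
  inner-isSubgroup = kernel-isSubgroup 𝕋ᶜ Degrees degree

  -- With trivial `w`, the remainders of `C(x)` and `D(x)` are the ratios `C(x)/C(y)` and
  -- `D(x)/D(y)`, which generate the Tutte group.
  tutteSplitting : Splitting tutte-isSubgroup
  tutteSplitting = splitting (Scaling.scaling-tutte 𝕋ᶜ _ b l λ _ → 𝕋ᶜ.refl)
    where
    open AbelianGroupProperties 𝕋ᶜ using (ε⁻¹≈ε)
    ratio : ∀ {t s s′} → s 𝕋ᶜ.≈ s′ → InTutte (t · s ⁻) → InTutte (t · s′ ⁻)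
    ratio s≈s′ = resp (𝕋ᶜ.∙-congˡ (𝕋ᶜ.⁻¹-cong s≈s′))
    open BasepointSplitting tutte-isSubgroup (λ _ → 1ʷ) (gen ε-gen)
      (λ C x y → ratio (𝕋ᶜ.sym (𝕋ᶜ.trans (𝕋ᶜ.identityˡ _) (𝕋ᶜ.trans (𝕋ᶜ.∙-congˡ ε⁻¹≈ε) (𝕋ᶜ.identityʳ _))))
        (gen (circuit-gen C x y)))
      (λ D x y → ratio (𝕋ᶜ.sym (𝕋ᶜ.trans (𝕋ᶜ.∙-congʳ ε⁻¹≈ε) (𝕋ᶜ.trans (𝕋ᶜ.identityˡ _) (𝕋ᶜ.identityʳ _))))
        (gen (cocircuit-gen D x y)))

  open Forest 𝕋ᶜ Degrees degree degᴱ

  module _ {c ℓ} (G : AbelianGroup c ℓ) where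
    open AbelianGroup G renaming (_-_ to _//_)
    open AbelianGroupProperties G

    -- Here `cx`, `cy` are degrees of generators of one circuit of degree `v`, and `wx`, `wy` are
    -- degrees of paths to a common root of degree `r`. The conclusion says that the remainder has
    -- degree zero.
    circuit-balance : ∀ {cx cy wx wy} ux uy r v → cx ≈ ux ∙ v → cy ≈ uy ∙ v →
      wx ≈ ux // r → wy ≈ uy // r → cx // (wx ∙ (cy // wy)) ≈ ε
    circuit-balance ux uy r v cx≈ cy≈ wx≈ wy≈ = x≈y⇒x∙y⁻¹≈ε (trans cx≈ (sym (trans
      (∙-cong wx≈ (∙-cong cy≈ (trans (⁻¹-cong wy≈) (sym (⁻¹-∙-comm _ _)))))
      (cancel-telescope G ux (inverseʳ uy) (inverseʳ (r ⁻¹))))))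

    cocircuit-balance : ∀ {dx dy wx wy} ux uy r v → dx ≈ ux ⁻¹ ∙ v → dy ≈ uy ⁻¹ ∙ v →
      wx ≈ ux // r → wy ≈ uy // r → dx // (wx ⁻¹ ∙ (dy ∙ wy)) ≈ ε
    cocircuit-balance ux uy r v dx≈ dy≈ wx≈ wy≈ = x≈y⇒x∙y⁻¹≈ε (trans dx≈ (sym (trans
      (∙-cong (trans (⁻¹-cong wx≈) (sym (⁻¹-∙-comm _ _))) (∙-cong dy≈ wy≈))
      (cancel-telescope G (ux ⁻¹) (inverseˡ uy) (inverseˡ (r ⁻¹))))))

    circuit-link : ∀ {cx cy} ux uy v → cx ≈ ux ∙ v → cy ≈ uy ∙ v → cx // cy ≈ ux // uy
    circuit-link ux uy v cx≈ cy≈ = trans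
      (∙-cong (trans cx≈ (∙-congˡ (sym (⁻¹-involutive v)))) (trans (⁻¹-cong cy≈) (⁻¹-anti-homo-∙ uy v)))
      (telescope G ux (v ⁻¹) uy)

    -- Elements enter the degree of a cocircuit generator negatively, hence the reversed quotient.
    cocircuit-link : ∀ {dx dy} ux uy v → dx ≈ ux ⁻¹ ∙ v → dy ≈ uy ⁻¹ ∙ v → dy // dx ≈ ux // uy
    cocircuit-link ux uy v dx≈ dy≈ = trans (circuit-link (uy ⁻¹) (ux ⁻¹) v dy≈ dx≈)
      (trans (comm _ _) (∙-congʳ (⁻¹-involutive ux)))

  circuit-linked : ∀ C → Linked (value C)
  circuit-linked C {x} {y} x∈C y∈C = C ⟨ x′ ⟩ · C ⟨ y′ ⟩ ⁻ ,
    circuit-link Degrees {degree₀ (C at x′)} {degree₀ (C at y′)} (degᴱ x) (degᴱ y) (degᶜ C)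
      (degree-circuit C x′) (degree-circuit C y′)
    where
    x′ y′ : Elem (value C)
    x′ = x , [ x∈C ]
    y′ = y , [ y∈C ]

  cocircuit-linked : ∀ D → Linked (value D)
  cocircuit-linked D {x} {y} x∈D y∈D = D ⟨ y′ ⟩* · D ⟨ x′ ⟩* ⁻ ,
    cocircuit-link Degrees {degree₀ (D at* x′)} {degree₀ (D at* y′)} (degᴱ x) (degᴱ y) (degᶜ* D)
      (degree-cocircuit D x′) (degree-cocircuit D y′)
    where
    x′ y′ : Elem (value D)
    x′ = x , [ x∈D ]
    y′ = y , [ y∈D ]

  private
    circuitSets cocircuitSets : List (Subset n)
    circuitSets   = map value (Enumeration.list circuits)
    cocircuitSets = map value (Enumeration.list cocircuits)

  forest : Rooting (circuitSets ++ cocircuitSets)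
  forest = rooting (All.++⁺ (All.map⁺ (All.universal circuit-linked (Enumeration.list circuits)))
                            (All.map⁺ (All.universal cocircuit-linked (Enumeration.list cocircuits))))
  open Rooting forest

  circuit-root : ∀ C (x y : Elem (value C)) → root (value x) ≡ root (value y)
  circuit-root C (x , [ x∈C ]) (y , [ y∈C ]) = constant
    (∈-++⁺ˡ (∈-map⁺ value (Enumeration.complete circuits C)))
    (recompute (x ∈? value C) x∈C) (recompute (y ∈? value C) y∈C)

  cocircuit-root : ∀ D (x y : Elem (value D)) → root (value x) ≡ root (value y)
  cocircuit-root D (x , [ x∈D ]) (y , [ y∈D ]) = constant
    (∈-++⁺ʳ circuitSets (∈-map⁺ value (Enumeration.complete cocircuits D)))
    (recompute (x ∈? value D) x∈D) (recompute (y ∈? value D) y∈D)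

  -- `w e` is a path from `e` to its root. All elements of a circuit or cocircuit share a root, so
  -- the remainders have degree zero.
  innerSplitting : Splitting inner-isSubgroup
  innerSplitting = splitting λ {t} → Scaling.scaling-inner 𝕋ᶜ w b l {t}
    where
    w : Fin n → Word Generator
    w = proj₁ ∘ path
    deg : Word Generator → 𝔻.Carrier
    deg = GroupHomomorphism.⟦_⟧ degree
    open BasepointSplitting inner-isSubgroup w ((λ _ → ≡.refl) , (λ _ → ≡.refl) , (λ _ → ≡.refl))
      (λ C x y → circuit-balance Degrees
        {degree₀ (C at x)} {degree₀ (C at y)} {deg (w (value x))} {deg (w (value y))}
        (degᴱ (value x)) (degᴱ (value y)) (degᴱ (root (value x))) (degᶜ C)
        (degree-circuit C x) (degree-circuit C y) (proj₂ (path (value x)))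
        (≡.subst (λ r → deg (w (value y)) 𝔻.≈ (degᴱ (value y) 𝔻.- degᴱ r))
          (circuit-root C y x) (proj₂ (path (value y)))))
      (λ D x y → cocircuit-balance Degrees
        {degree₀ (D at* x)} {degree₀ (D at* y)} {deg (w (value x))} {deg (w (value y))}
        (degᴱ (value x)) (degᴱ (value y)) (degᴱ (root (value x))) (degᶜ* D)
        (degree-cocircuit D x) (degree-cocircuit D y) (proj₂ (path (value x)))
        (≡.subst (λ r → deg (w (value y)) 𝔻.≈ (degᴱ (value y) 𝔻.- degᴱ r))
          (cocircuit-root D y x) (proj₂ (path (value y)))))

-- Enumerations of the elements of a subset.

lookup-injective : ∀ {A : Set} {xs : List A} → Unique xs → Injective _≡_ _≡_ (lookup xs)
lookup-injective (_ ∷ _)     {Fin.zero}  {Fin.zero}  _  = ≡.refl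
lookup-injective (x≢ ∷ _)    {Fin.zero}  {Fin.suc j} eq = contradiction eq (All.lookup x≢ (∈-lookup j))
lookup-injective (x≢ ∷ _)    {Fin.suc i} {Fin.zero}  eq = contradiction (≡.sym eq) (All.lookup x≢ (∈-lookup i))
lookup-injective (_ ∷ xs!)   {Fin.suc i} {Fin.suc j} eq = ≡.cong Fin.suc (lookup-injective xs! eq)

-- Repetition-free lists with the same members have the same multiplicities.
enumeration-↭ : ∀ {A : Set} (E F : Enumeration A) → Enumeration.list E ↭ Enumeration.list F
enumeration-↭ E F = ∼bag⇒↭ (unique∧set⇒bag E.unique F.unique
  (mk⇔ (λ _ → F.complete _) (λ _ → E.complete _)))
  where
  module E = Enumeration E
  module F = Enumeration F

elements-complete : ∀ {n} (p : Subset n) (x : Elem p) → x List.∈ elements p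
elements-complete (inside  ∷ p) (Fin.zero , _)        = here ≡.refl
elements-complete (outside ∷ p) (Fin.zero , [ x∈p ])  = contradiction-irr x∈p λ ()
elements-complete (inside  ∷ p) (Fin.suc x , [ x∈p ]) =
  there (∈-map⁺ _ (elements-complete p (x , [ drop-there x∈p ])))
elements-complete (outside ∷ p) (Fin.suc x , [ x∈p ]) =
  ∈-map⁺ _ (elements-complete p (x , [ drop-there x∈p ]))

elements-unique : ∀ {n} (p : Subset n) → Unique (elements p)
elements-unique []            = []
elements-unique (inside  ∷ p) =
  All.map⁺ (All.universal (λ _ ()) (elements p)) ∷ Unique.map⁺ (λ { ≡.refl → ≡.refl }) (elements-unique p)
elements-unique (outside ∷ p) = Unique.map⁺ (λ { ≡.refl → ≡.refl }) (elements-unique p)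

length-elements : ∀ {n} (p : Subset n) → length (elements p) ≡ ∣ p ∣
length-elements []            = ≡.refl
length-elements (inside  ∷ p) = ≡.cong suc (≡.trans (length-map _ (elements p)) (length-elements p))
length-elements (outside ∷ p) = ≡.trans (length-map _ (elements p)) (length-elements p)

elementEnumeration : ∀ {n} (p : Subset n) → Enumeration (Elem p)
elementEnumeration p = record
  { list = elements p ; unique = elements-unique p ; complete = elements-complete p }

module _ {n k} {p : Subset n} {x : Fin k → Fin n} (enum : Enumerates p x) where

  enumerated : Fin k → Elem p
  enumerated i = x i , [ Function.Equivalence.from (proj₂ enum (x i)) (i , ≡.refl) ]

  enumeratedEnumeration : Enumeration (Elem p)
  enumeratedEnumeration = record
    { list     = tabulate enumerated
    ; unique   = Unique.tabulate⁺ (proj₁ enum ∘ ≡.cong value)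
    ; complete = complete
    }
    where
    complete : ∀ e → e List.∈ tabulate enumerated
    complete (e , [ e∈p ]) with i , ≡.refl ← Function.Equivalence.to (proj₂ enum e) (recompute (e ∈? p) e∈p) =
      ∈-tabulate⁺ {f = enumerated} i

  elements↭enumerated : elements p ↭ tabulate enumerated
  elements↭enumerated = enumeration-↭ (elementEnumeration p) enumeratedEnumeration

  ∣p∣≡k : ∣ p ∣ ≡ k
  ∣p∣≡k = ≡.trans (≡.sym (length-elements p)) (≡.trans (↭-length elements↭enumerated) (length-tabulate enumerated))

enumerates-zero≢suc : ∀ {n k} {p : Subset n} {x : Fin (suc k) → Fin n} → Enumerates p x →
                      ∀ j → x Fin.zero ≢ x (Fin.suc j)
enumerates-zero≢suc (injective , _) j eq = contradiction (injective eq) λ ()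

-- The list comes with an equation so that `L` can be matched on by its length.
enumerates-lookup : ∀ {n} (p : Subset n) {L} → elements p ≡ L → Enumerates p (value ∘ lookup L)
enumerates-lookup p ≡.refl =
    lookup-injective (elements-unique p) ∘ Refinement.value-injective
  , λ e → mk⇔ (λ e∈p → let e∈L = elements-complete p (e , [ e∈p ]) in
                       index e∈L , ≡.cong value (≡.sym (lookup-index e∈L)))
              (λ { (i , ≡.refl) → elem∈ (lookup (elements p) i) })
  where
  elem∈ : ∀ (x : Elem p) → value x ∈ p
  elem∈ (x , [ x∈p ]) = recompute (x ∈? p) x∈p

∈-pairˡ : ∀ {n} {p : Subset n} {x y} → p ≡ ⁅ x ⁆ ∪ ⁅ y ⁆ → x ∈ p
∈-pairˡ {x = x} ≡.refl = x∈p∪q⁺ (inj₁ (x∈⁅x⁆ x))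

∈-pairʳ : ∀ {n} {p : Subset n} {x y} → p ≡ ⁅ x ⁆ ∪ ⁅ y ⁆ → y ∈ p
∈-pairʳ {y = y} ≡.refl = x∈p∪q⁺ (inj₂ (x∈⁅x⁆ y))

enumerates-pair : ∀ {n} {p : Subset n} {x : Fin 2 → Fin n} → Enumerates p x →
                  p ≡ ⁅ x Fin.zero ⁆ ∪ ⁅ x (Fin.suc Fin.zero) ⁆
enumerates-pair {p = p} {x} (_ , mem) = ⊆-antisym p⊆ ⊆p
  where
  open Function.Equivalence
  p⊆ : p ⊆ ⁅ x Fin.zero ⁆ ∪ ⁅ x (Fin.suc Fin.zero) ⁆
  p⊆ {e} e∈p with to (mem e) e∈p
  ... | Fin.zero , ≡.refl         = x∈p∪q⁺ (inj₁ (x∈⁅x⁆ _))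
  ... | Fin.suc Fin.zero , ≡.refl = x∈p∪q⁺ (inj₂ (x∈⁅x⁆ _))
  ⊆p : ⁅ x Fin.zero ⁆ ∪ ⁅ x (Fin.suc Fin.zero) ⁆ ⊆ p
  ⊆p {e} e∈ = from (mem e) ([ (λ e∈⁅x⁆ → Fin.zero , ≡.sym (x∈⁅y⁆⇒x≡y _ e∈⁅x⁆))
                            , (λ e∈⁅y⁆ → Fin.suc Fin.zero , ≡.sym (x∈⁅y⁆⇒x≡y _ e∈⁅y⁆)) ]′
                            (x∈p∪q⁻ ⁅ x Fin.zero ⁆ ⁅ x (Fin.suc Fin.zero) ⁆ e∈))

pairEnumeration : ∀ {n} {p : Subset n} (x y : Elem p) → value x ≢ value y →
                  p ≡ ⁅ value x ⁆ ∪ ⁅ value y ⁆ → Enumeration (Elem p)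
pairEnumeration {p = p} x y x≢y p≡ = record
  { list     = x ∷ y ∷ []
  ; unique   = ((λ { ≡.refl → x≢y ≡.refl }) ∷ []) ∷ [] ∷ []
  ; complete = complete
  }
  where
  complete : ∀ e → e List.∈ x ∷ y ∷ []
  complete (e , [ e∈p ])
    with x∈p∪q⁻ ⁅ value x ⁆ ⁅ value y ⁆ (≡.subst (e ∈_) p≡ (recompute (e ∈? p) e∈p))
  ... | inj₁ e∈⁅x⁆ with ≡.refl ← x∈⁅y⁆⇒x≡y (value x) e∈⁅x⁆ = here ≡.refl
  ... | inj₂ e∈⁅y⁆ with ≡.refl ← x∈⁅y⁆⇒x≡y (value y) e∈⁅y⁆ = there (here ≡.refl)

-- Hypersums and additive inverses.

module HyperfieldProperties {c ℓ h} (ℍ : Hyperfield c ℓ h) where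
  open Hyperfield ℍ

  -- Hypersums are bracketed to the right, so a swap of neighbours is reassociation, commutation,
  -- and reassociation back.
  ⊞∑-↭ : ∀ {as bs z} → as ↭ bs → ⊞∑ as z → ⊞∑ bs z
  ⊞∑-↭ ↭.refl          z∈               = z∈
  ⊞∑-↭ (↭.prep a p)    (z∈ ∷ y∈)        = z∈ ∷ ⊞∑-↭ p y∈
  ⊞∑-↭ (↭.swap a b p)  (z∈ ∷ y∈ ∷ w∈)
    with u , u∈ , z∈′ ← proj₂ (⊞-assoc a b _) (_ , y∈ , z∈)
    with v , v∈ , z∈″ ← proj₁ (⊞-assoc b a _) (u , proj₁ (⊞-comm a b) u∈ , z∈′) =
    z∈″ ∷ v∈ ∷ ⊞∑-↭ p w∈
  ⊞∑-↭ (↭.trans p q)   z∈               = ⊞∑-↭ q (⊞∑-↭ p z∈)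

  ⊞∑-tabulate-scale : ∀ {k} {f g : Fin k → Carrier} {z z′} b → (∀ j → b ⊙ f j ≈ g j) → b ⊙ z ≈ z′ →
                      ⊞∑ (tabulate f) z → ⊞∑ (tabulate g) z′
  ⊞∑-tabulate-scale {zero}  b bf≈g bz≈z′ ([] z≈0)  =
    [] (trans (sym bz≈z′) (trans (∙-congˡ z≈0) (zeroʳ b)))
  ⊞∑-tabulate-scale {suc k} b bf≈g bz≈z′ (z∈ ∷ y∈) =
    ⊞-resp-≈ (bf≈g Fin.zero) refl bz≈z′ (proj₁ (distribˡ b _ _) (_ , z∈ , refl))
    ∷ ⊞∑-tabulate-scale b (bf≈g ∘ Fin.suc) refl y∈

  ⊞∑-tabulate-cong : ∀ {k} {f g : Fin k → Carrier} {z} → (∀ j → f j ≈ g j) →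
                     ⊞∑ (tabulate f) z → ⊞∑ (tabulate g) z
  ⊞∑-tabulate-cong f≈g = ⊞∑-tabulate-scale 1# (λ j → trans (identityˡ _) (f≈g j)) (identityˡ _)

  x⊞0 : ∀ {x v w} → v ≈ 0# → (x ⊞ v) w → x ≈ w
  x⊞0 {x} v≈0 w∈ = proj₁ (⊞-identity x) (proj₁ (⊞-comm x 0#) (⊞-resp-≈ refl v≈0 refl w∈))

  ⊞∑-singleton : ∀ {x} → ⊞∑ (x ∷ []) x
  ⊞∑-singleton {x} = proj₂ (⊞-comm x 0#) (proj₂ (⊞-identity x) refl) ∷ [] refl

  0∈x⊞y⇒y≈-x : ∀ {x y} → ⊞∑ (x ∷ y ∷ []) 0# → y ≈ - x
  0∈x⊞y⇒y≈-x (0∈ ∷ w∈ ∷ [] v≈0) = trans (x⊞0 v≈0 w∈) (-‿unique 0∈)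

  -‿cong : ∀ {x y} → x ≈ y → - x ≈ - y
  -‿cong {x} x≈y = -‿unique (⊞-resp-≈ x≈y refl refl (⊞-inverse x))

  -- Multiplying `0 ∈ 1 ⊞ -1` by `x` shows that `x ⊙ - 1#` is an additive inverse of `x`, and that
  -- inverse is unique.
  -‿⊙ : ∀ x → - x ≈ - 1# ⊙ x
  -‿⊙ x = trans (sym (-‿unique
    (⊞-resp-≈ (identityʳ x) refl (zeroʳ x) (proj₁ (distribˡ x 1# (- 1#)) (0# , ⊞-inverse 1# , refl)))))
    (comm x (- 1#))

  -1*-1≈1 : - 1# ⊙ - 1# ≈ 1#
  -1*-1≈1 = trans (sym (-‿⊙ (- 1#))) (sym (-‿unique (proj₁ (⊞-comm 1# (- 1#)) (⊞-inverse 1#))))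

  module _ {k} (t₀ : Nonzero) {t u : Fin k → Carrier} (t≈-t₀u : ∀ j → t j ≈ - val t₀ ⊙ u j) where

    -- Scaling by `-t₀` shows that `-t₀` lies in the hypersum of the `t j`, and `0 ∈ t₀ ⊞ -t₀`.
    1∈⊞∑⇒0∈⊞∑ : ⊞∑ (tabulate u) 1# → ⊞∑ (val t₀ ∷ tabulate t) 0#
    1∈⊞∑⇒0∈⊞∑ 1∈ = ⊞-inverse (val t₀) ∷
      ⊞∑-tabulate-scale (- val t₀) (λ j → sym (t≈-t₀u j)) (identityʳ _) 1∈

    -- By uniqueness of additive inverses the partial sum after `t₀` is `-t₀`, which can be divided
    -- out.
    0∈⊞∑⇒1∈⊞∑ : ⊞∑ (val t₀ ∷ tabulate t) 0# → ⊞∑ (tabulate u) 1#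
    0∈⊞∑⇒1∈⊞∑ (0∈ ∷ y∈) with s , s-t₀≈1 ← ⊙-inverse (-‿≉0 (val≉0 t₀)) =
      ⊞∑-tabulate-scale s
        (λ j → trans (∙-congˡ (t≈-t₀u j)) (trans (sym (assoc _ _ _))
          (trans (∙-congʳ s-t₀≈1) (identityˡ _))))
        (trans (∙-congˡ (-‿unique 0∈)) s-t₀≈1) y∈

-- Ratios and cross ratios in abelian groups.

module _ {c ℓ} (G : AbelianGroup c ℓ) where
  open AbelianGroup G renaming (_-_ to _//_)
  open AbelianGroupProperties G
  open CommutativeSemigroupProperties commutativeSemigroup
  open SetoidReasoning setoid

  ratio⇒scaled : ∀ {x y z} → x // y ≈ z → x ≈ z ∙ y
  ratio⇒scaled {x} {y} x/y≈z = trans (sym (//-rightDividesˡ y x)) (∙-congʳ x/y≈z)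

  scaled⇒ratio : ∀ {x y z} → x ≈ z ∙ y → x // y ≈ z
  scaled⇒ratio {x} {y} {z} x≈zy = sym (x≈z//y z y x (sym x≈zy))

  -- Collects the scalars of a chain of `∼`, `≈τ` and `∼`: one factor for the element, one for the
  -- circuit or cocircuit.
  regroup : ∀ b h b′ g → b ∙ (h ∙ (b′ ∙ g)) ≈ (h ∙ (b ∙ b′)) ∙ g
  regroup b h b′ g = begin
    b ∙ (h ∙ (b′ ∙ g))    ≈⟨ x∙yz≈y∙xz b h _ ⟩
    h ∙ (b ∙ (b′ ∙ g))    ≈⟨ ∙-congˡ (assoc b b′ g) ⟨
    h ∙ ((b ∙ b′) ∙ g)    ≈⟨ assoc h _ g ⟨
    (h ∙ (b ∙ b′)) ∙ g    ∎

  -- Primed letters belong to an auxiliary circuit and `m` is the image of `εᴹ`. The hypothesis is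
  -- its exchange relation with `D`, which determines `dy // dx`.
  exchange⇒crossRatio : ∀ {cx cy cx′ cy′ dx dy} m → cy′ ∙ dy ≈ m ∙ (cx′ ∙ dx) →
    cy ∙ dy ≈ (m ∙ (cx ∙ dx)) ∙ ((cy ∙ cx′) // (cx ∙ cy′))
  exchange⇒crossRatio {cx} {cy} {cx′} {cy′} {dx} {dy} m eq = trans (x≈z//y _ _ _ (begin
    (cy ∙ dy) ∙ (cx ∙ cy′)          ≈⟨ ∙-cong (comm cy dy) (comm cx cy′) ⟩
    (dy ∙ cy) ∙ (cy′ ∙ cx)          ≈⟨ interchange dy cy cy′ cx ⟩
    (dy ∙ cy′) ∙ (cy ∙ cx)          ≈⟨ ∙-congʳ (trans (comm dy cy′) eq) ⟩
    (m ∙ (cx′ ∙ dx)) ∙ (cy ∙ cx)    ≈⟨ assoc _ _ _ ⟩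
    m ∙ ((cx′ ∙ dx) ∙ (cy ∙ cx))    ≈⟨ ∙-congˡ (trans (∙-cong (comm _ _) (comm _ _)) (interchange dx cx′ cx cy)) ⟩
    m ∙ ((dx ∙ cx) ∙ (cx′ ∙ cy))    ≈⟨ ∙-congˡ (∙-cong (comm _ _) (comm _ _)) ⟩
    m ∙ ((cx ∙ dx) ∙ (cy ∙ cx′))    ≈⟨ assoc _ _ _ ⟨
    (m ∙ (cx ∙ dx)) ∙ (cy ∙ cx′)    ∎)) (assoc _ _ _)

-- Orthogonality in terms of cross ratios.

module Correspondence {n} (M : Matroid n) {c ℓ h} (ℍ : Hyperfield c ℓ h) (involution : Involution ℍ) where
  open Matroid M
  open MatroidProperties M
  open Tutte M
  open TutteProperties M
  open Presentation Relation using (rel; eval; extend)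
  open Hyperfield ℍ
  open HyperfieldProperties ℍ
  open Involution involution
  open HyperfieldMatroids M ℍ involution
  open SignatureProperties
  open AbelianGroupProperties ℍ* using (x≈y⇒x∙y⁻¹≈ε; x∙y⁻¹≈ε⇒x≈y; ε⁻¹≈ε)
  open CommutativeSemigroupProperties ℍ*.commutativeSemigroup using (xy∙z≈y∙xz)
  private module 𝕋ᶜ = AbelianGroup 𝕋ᶜ

  orthogonalAt-along : ∀ p C D (enum : Enumeration (Elem (value C ∩ value D))) →
    OrthogonalAt p C D → ⊞∑ (map (terms p C D) (Enumeration.list enum)) 0#
  orthogonalAt-along p C D enum = ⊞∑-↭ (↭-map⁺ (terms p C D) (enumeration-↭ (elementEnumeration _) enum))

  orthogonalAt-from : ∀ p C D (enum : Enumeration (Elem (value C ∩ value D))) →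
    ⊞∑ (map (terms p C D) (Enumeration.list enum)) 0# → OrthogonalAt p C D
  orthogonalAt-from p C D enum = ⊞∑-↭ (↭-map⁺ (terms p C D) (enumeration-↭ enum (elementEnumeration _)))

  orthogonal-≤3 : ∀ s {p} → Orthogonal s p → ∀ C D → ∣ value C ∩ value D ∣ ≤ 3 → OrthogonalAt p C D
  orthogonal-≤3 strong p⊥ C D _  = p⊥ C D
  orthogonal-≤3 weak   p⊥ C D ≤3 = p⊥ C D ≤3

  -- Memberships are irrelevant, so at enumerated points these elements agree definitionally with
  -- those in `ConditionAt`.
  shared : ∀ (C C′ : Circuit) (D : Cocircuit) (x : Elem (value C ∩ value D)) →
           .(value x ∈ value C′ ∩ value D) → Elem (value C ∩ value C′)
  shared C C′ D (x , [ x∈ ]) x∈′ =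
    x , [ x∈p∩q⁺ (p∩q⊆p (value C) (value D) x∈ , p∩q⊆p (value C′) (value D) x∈′) ]

  module _ (Φ : TutteHomomorphism extendedTutteGroup) (C : Circuit) (D : Cocircuit) where
    private module Φ = TutteHomomorphism Φ

    terms-signatures : ∀ x → terms (signatures Φ) C D x ≈ val (⟦ Φ ⟧ (pairing C D x))
    terms-signatures x = trans (∙-congˡ (τ-involutive _)) (sym (≈*⇒≈ (Φ.homo _ _)))

    -- As `Φ` sends `ε₀` to `-1`, the exchange relation of `C′` and `D` makes the image of
    -- `D(y)/D(x)` the negative of the image of `C′(x)/C′(y)`.
    pairing-crossRatio : ∀ (C′ : Circuit) (x y : Elem (value C ∩ value D)) → value x ≢ value y →
      (C′∩D : value C′ ∩ value D ≡ ⁅ value x ⁆ ∪ ⁅ value y ⁆) →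
      val (⟦ Φ ⟧ (pairing C D y)) ≈ - val (⟦ Φ ⟧ (pairing C D x))
        ⊙ val (⟦ Φ ⟧ (crossRatioᶜ C C′ (shared C C′ D y (∈-pairʳ C′∩D)) (shared C C′ D x (∈-pairˡ C′∩D))))
    pairing-crossRatio C′ x y x≢y C′∩D = trans
      (≈*⇒≈ (ℍ*.trans (Φ.homo _ _) (exchange⇒crossRatio ℍ*
        {cx = ⟦ Φ ⟧ (C ⟨ inˡ (value C) (value D) x ⟩)} {cx′ = ⟦ Φ ⟧ (C′ ⟨ inˡ (value C′) (value D) x′ ⟩)}
        (-* 1*)
        (ℍ*.trans (ℍ*.sym (Φ.homo _ _)) (ℍ*.trans (Φ.⟦⟧-cong (rel exchanged))
          (ℍ*.trans (Φ.homo _ _) (ℍ*.∙-cong Φ.εᴹ-homo (Φ.homo _ _))))))))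
      (∙-cong (trans (sym (-‿⊙ _)) (-‿cong (≈*⇒≈ (ℍ*.sym (Φ.homo _ _)))))
        (≈*⇒≈ (ℍ*.sym (ℍ*.trans (Φ.homo _ _) (ℍ*.∙-cong (Φ.homo _ _)
          (ℍ*.trans (Φ.⁻¹-homo _) (ℍ*.⁻¹-cong (Φ.homo _ _))))))))
      where
      x′ y′ : Elem (value C′ ∩ value D)
      x′ = value x , [ ∈-pairˡ C′∩D ]
      y′ = value y , [ ∈-pairʳ C′∩D ]
      exchanged : Relation (pairing C′ D y′) (ε₀ · pairing C′ D x′)
      exchanged = exchange C′ D y′ x′ (x≢y ∘ ≡.sym) (≡.trans C′∩D (∪-comm ⁅ value x ⁆ ⁅ value y ⁆))

    module _ {k} {x : Fin (suc k) → Fin n} (enum : Enumerates (value C ∩ value D) x) where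

      pairings : Fin (suc k) → Carrier
      pairings i = val (⟦ Φ ⟧ (pairing C D (enumerated enum i)))

      orthogonalAt⇒0∈ : OrthogonalAt (signatures Φ) C D → ⊞∑ (tabulate pairings) 0#
      orthogonalAt⇒0∈ orth = ⊞∑-tabulate-cong (λ i → terms-signatures (enumerated enum i))
        (≡.subst (λ as → ⊞∑ as 0#) (map-tabulate (enumerated enum) (terms (signatures Φ) C D))
          (orthogonalAt-along (signatures Φ) C D (enumeratedEnumeration enum) orth))

      0∈⇒orthogonalAt : ⊞∑ (tabulate pairings) 0# → OrthogonalAt (signatures Φ) C D
      0∈⇒orthogonalAt 0∈ = orthogonalAt-from (signatures Φ) C D (enumeratedEnumeration enum)
        (≡.subst (λ as → ⊞∑ as 0#) (≡.sym (map-tabulate (enumerated enum) (terms (signatures Φ) C D)))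
          (⊞∑-tabulate-cong (λ i → sym (terms-signatures (enumerated enum i))) 0∈))

  orthogonalAt⇒conditionAt : ∀ Φ k →
    (∀ C D → ∣ value C ∩ value D ∣ ≡ suc k → OrthogonalAt (signatures Φ) C D) → ConditionAt Φ k
  orthogonalAt⇒conditionAt Φ k orth C D x enum C′ C′∩D =
    0∈⊞∑⇒1∈⊞∑ (⟦ Φ ⟧ (pairing C D (enumerated enum Fin.zero)))
      (λ j → pairing-crossRatio Φ C D (C′ j) (enumerated enum Fin.zero) (enumerated enum (Fin.suc j))
        (enumerates-zero≢suc enum j) (C′∩D j))
      (orthogonalAt⇒0∈ Φ C D enum (orth C D (∣p∣≡k enum)))

  -- By the size of `C ∩ D`: an empty hypersum is zero, size one is impossible, size two follows
  -- from the exchange relation, and larger sizes from the condition for fundamental circuits.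
  conditionAt⇒orthogonalAt : ∀ Φ C D →
    (∀ k → 2 ≤ k → ∣ value C ∩ value D ∣ ≡ suc k → ConditionAt Φ k) → OrthogonalAt (signatures Φ) C D
  conditionAt⇒orthogonalAt Φ C D condition = go (elements (value C ∩ value D)) ≡.refl
    where
    module Φ = TutteHomomorphism Φ
    module 𝕋ᶜP = AbelianGroupProperties 𝕋ᶜ
    p : Subset n
    p = value C ∩ value D
    go : ∀ L → elements p ≡ L → OrthogonalAt (signatures Φ) C D
    go [] eq = ≡.subst (λ L → ⊞∑ (map (terms (signatures Φ) C D) L) 0#) (≡.sym eq) ([] refl)
    go (x ∷ []) eq = ⊥-elim (circuit∩cocircuit≢⁅e⁆ (isCircuit C) (isCocircuit D)
      (p∩q⊆p _ _ x∈p) (p∩q⊆q _ _ x∈p) only′)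
      where
      x∈p : value x ∈ p
      x∈p = Function.Equivalence.from (proj₂ (enumerates-lookup p eq) _) (Fin.zero , ≡.refl)
      only : ∀ {z} → z List.∈ x ∷ [] → value z ≡ value x
      only (here ≡.refl) = ≡.refl
      only′ : ∀ {z} → z ∈ value C → z ∈ value D → z ≡ value x
      only′ {z} z∈C z∈D = only (≡.subst ((z , [ x∈p∩q⁺ (z∈C , z∈D) ]) List.∈_) eq (elements-complete p _))
    -- `C` serves as its own auxiliary circuit; its cross ratio with itself is trivial, which leaves
    -- `1 ∈ {1}`.
    go (x ∷ y ∷ []) eq = 0∈⇒orthogonalAt Φ C D enum
      (1∈⊞∑⇒0∈⊞∑ (⟦ Φ ⟧ (pairing C D x₀)) {t = λ _ → val (⟦ Φ ⟧ (pairing C D x₁))} {u = λ _ → 1#}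
        (λ _ → trans (pairing-crossRatio Φ C D C x₀ x₁ (enumerates-zero≢suc enum Fin.zero) (enumerates-pair enum))
                     (∙-congˡ (≈*⇒≈ (ℍ*.trans (Φ.⟦⟧-cong (𝕋ᶜP.x≈y⇒x∙y⁻¹≈ε (𝕋ᶜ.comm _ _))) Φ.ε-homo))))
        ⊞∑-singleton)
      where
      enum : Enumerates p (value ∘ lookup (x ∷ y ∷ []))
      enum = enumerates-lookup p eq
      x₀ x₁ : Elem p
      x₀ = enumerated enum Fin.zero
      x₁ = enumerated enum (Fin.suc Fin.zero)
    go (x₀ ∷ x₁ ∷ x₂ ∷ L) eq = 0∈⇒orthogonalAt Φ C D enum
      (1∈⊞∑⇒0∈⊞∑ (⟦ Φ ⟧ (pairing C D (enumerated enum Fin.zero)))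
        (λ j → pairing-crossRatio Φ C D (C′ j) (enumerated enum Fin.zero) (enumerated enum (Fin.suc j))
          (enumerates-zero≢suc enum j) (proj₂ (through j)))
        (condition _ (ℕ.s≤s (ℕ.s≤s ℕ.z≤n)) (∣p∣≡k enum) C D x enum C′ (λ j → proj₂ (through j))))
      where
      x : Fin (3 ℕ.+ length L) → Fin n
      x = value ∘ lookup (x₀ ∷ x₁ ∷ x₂ ∷ L)
      enum : Enumerates p x
      enum = enumerates-lookup p eq
      x∈D : ∀ i → x i ∈ value D
      x∈D i = p∩q⊆q (value C) (value D) (Function.Equivalence.from (proj₂ enum (x i)) (i , ≡.refl))
      through : ∀ j → ∃ λ (C′ : Circuit) → value C′ ∩ value D ≡ ⁅ x Fin.zero ⁆ ∪ ⁅ x (Fin.suc j) ⁆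
      through j = circuitThrough D (x∈D Fin.zero) (x∈D (Fin.suc j)) (enumerates-zero≢suc enum j)
      C′ : Fin (2 ℕ.+ length L) → Circuit
      C′ = proj₁ ∘ through

  -- The intersection has `k + 1` elements, so the bound 3 of weak orthogonality amounts to `k ≤ 2`.
  condition⇒orthogonal : ∀ s Φ → Condition Φ s → Orthogonal s (signatures Φ)
  condition⇒orthogonal strong Φ cond C D    = conditionAt⇒orthogonalAt Φ C D λ k 2≤k _ → cond k 2≤k
  condition⇒orthogonal weak   Φ cond C D ≤3 = conditionAt⇒orthogonalAt Φ C D λ k 2≤k size →
    cond k 2≤k (ℕ.s≤s⁻¹ (≡.subst (_≤ 3) size ≤3))

  orthogonal⇒condition : ∀ s Φ → Orthogonal s (signatures Φ) → Condition Φ s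
  orthogonal⇒condition strong Φ orth k _     = orthogonalAt⇒conditionAt Φ k λ C D _ → orth C D
  orthogonal⇒condition weak   Φ orth k _ k≤2 = orthogonalAt⇒conditionAt Φ k λ C D size →
    orth C D (≡.subst (_≤ 3) (≡.sym size) (ℕ.s≤s k≤2))

  -- From orthogonal signatures to homomorphisms.

  τ*-cong : ∀ {x y} → x ℍ*.≈ y → τ* x ℍ*.≈ τ* y
  τ*-cong x≈y = ⟪ τ-cong (≈*⇒≈ x≈y) ⟫

  τ*-∙ : ∀ x y → τ* (x ℍ*.∙ y) ℍ*.≈ τ* x ℍ*.∙ τ* y
  τ*-∙ x y = ⟪ τ-⊙ (val x) (val y) ⟫

  τ*-involutive : ∀ x → τ* (τ* x) ℍ*.≈ x
  τ*-involutive x = ⟪ τ-involutive (val x) ⟫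

  τ*-injective : ∀ {x y} → τ* x ℍ*.≈ τ* y → x ℍ*.≈ y
  τ*-injective τx≈τy = ℍ*.trans (ℍ*.sym (τ*-involutive _)) (ℍ*.trans (τ*-cong τx≈τy) (τ*-involutive _))

  τ*-transpose : ∀ {a x y} → τ* x ℍ*.≈ a ℍ*.∙ τ* y → x ℍ*.≈ τ* a ℍ*.∙ y
  τ*-transpose τx≈aτy = ℍ*.trans (ℍ*.sym (τ*-involutive _)) (ℍ*.trans (τ*-cong τx≈aτy)
    (ℍ*.trans (τ*-∙ _ _) (ℍ*.∙-congˡ (τ*-involutive _))))

  ≈ˢ⇒∼ : ∀ {p q} → p ≈ˢ q → p ∼ q
  ≈ˢ⇒∼ (γ≈ , δ≈) = (λ _ → ℍ*.ε) , (λ _ → ℍ*.ε)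
    , (λ C x → ℍ*.trans (γ≈ C x) (ℍ*.sym (ℍ*.identityˡ _)))
    , (λ D y → ℍ*.trans (δ≈ D y) (ℍ*.sym (ℍ*.identityˡ _)))

  homs-agree : ∀ (Φ Ψ : TutteHomomorphism extendedTutteGroup) → signatures Φ ≈ˢ signatures Ψ → Φ ≗ᴴ Ψ
  homs-agree Φ Ψ (γ≈ , δ≈) = ∈-words (equalizer-isSubgroup 𝕋ᶜ ℍ* Φ.homomorphism Ψ.homomorphism) λ
    { epsilon   → ℍ*.trans Φ.εᴹ-homo (ℍ*.sym Ψ.εᴹ-homo)
    ; (C at x)  → γ≈ C x
    ; (D at* y) → τ*-injective (δ≈ D y)
    }
    where
    module Φ = TutteHomomorphism Φ
    module Ψ = TutteHomomorphism Ψ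

  module FromSignatures (s : Strength) (p : Signatures) (p⊥ : Orthogonal s p) where

    onGenerators : Generator → Nonzero
    onGenerators epsilon   = -* 1*
    onGenerators (C at x)  = γ p C x
    onGenerators (D at* y) = τ* (δ p D y)

    -- Two terms whose hypersum contains zero are negatives of each other. The intersection has size
    -- two, so weak orthogonality applies as well.
    onGenerators-relation : ∀ {u v} → Relation u v → eval ℍ* onGenerators u ℍ*.≈ eval ℍ* onGenerators v
    onGenerators-relation ε² = ⟪ -1*-1≈1 ⟫
    onGenerators-relation (exchange C D x y x≢y C∩D) = ⟪ trans (0∈x⊞y⇒y≈-x
      (orthogonalAt-along p C D pair (orthogonal-≤3 s p⊥ C D size))) (-‿⊙ _) ⟫
      where
      -- `y` comes first because `0∈x⊞y⇒y≈-x` solves for the second term, and the relation expresses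
      -- the pairing at `x`.
      pair : Enumeration (Elem (value C ∩ value D))
      pair = pairEnumeration y x (x≢y ∘ ≡.sym) (≡.trans C∩D (∪-comm ⁅ value x ⁆ ⁅ value y ⁆))
      size : ∣ value C ∩ value D ∣ ≤ 3
      size = ≡.subst (_≤ 3) (≡.trans (≡.sym (↭-length (enumeration-↭ (elementEnumeration _) pair)))
                                    (length-elements (value C ∩ value D)))
        (ℕ.s≤s (ℕ.s≤s ℕ.z≤n))

    hom : TutteHomomorphism extendedTutteGroup
    hom = record { homomorphism = extend ℍ* onGenerators onGenerators-relation ; εᴹ-homo = ℍ*.refl }

    signatures-hom : signatures hom ≈ˢ p
    signatures-hom = (λ _ _ → ℍ*.refl) , (λ _ _ → τ*-involutive _)

    condition : Condition hom s
    condition = orthogonal⇒condition s hom (orthogonal-∼ s (≈ˢ⇒∼ signatures-hom) p⊥)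

  -- Ratios of homomorphisms, and their scalings.

  module _ (Φ Ψ : TutteHomomorphism extendedTutteGroup) where
    private
      module Φ = TutteHomomorphism Φ
      module Ψ = TutteHomomorphism Ψ

      ratio : Hom 𝕋ᶜ ℍ*
      ratio = quotient 𝕋ᶜ ℍ* Φ.homomorphism Ψ.homomorphism
      module ratio = GroupHomomorphism ratio

    -- Describes the ratio as a scaling; on `epsilon` it is always trivial, since both homomorphisms
    -- take the value `-1` there.
    record ScaledBy (η : Fin n → Nonzero) (b : Circuit → Nonzero) (l : Cocircuit → Nonzero) : Set ℓ where
      field
        on-circuits   : ∀ C x → ratio.⟦ C ⟨ x ⟩ ⟧ ℍ*.≈ η (value x) ℍ*.∙ b C
        on-cocircuits : ∀ D y → ratio.⟦ D ⟨ y ⟩* ⟧ ℍ*.≈ η (value y) ℍ*.⁻¹ ℍ*.∙ l D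

    module _ {η b l} (scaled : ScaledBy η b l) where
      open ScaledBy scaled
      open Scaling ℍ* η b l
      private module scaling = GroupHomomorphism scaling

      ratio≈scaling : ∀ t → ratio.⟦ t ⟧ ℍ*.≈ scaling.⟦ t ⟧
      ratio≈scaling = ∈-words (equalizer-isSubgroup 𝕋ᶜ ℍ* ratio scaling) λ where
        epsilon   → ℍ*.trans (x≈y⇒x∙y⁻¹≈ε (ℍ*.trans Φ.εᴹ-homo (ℍ*.sym Ψ.εᴹ-homo))) (ℍ*.sym scaling-ε)
        (C at x)  → ℍ*.trans (on-circuits C x) (ℍ*.sym (scaling-circuit C x))
        (D at* y) → ℍ*.trans (on-cocircuits D y) (ℍ*.sym (scaling-cocircuit D y))

      scaled⇒agree-inner : ∀ t → InInner t → ⟦ Φ ⟧ t ℍ*.≈ ⟦ Ψ ⟧ t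
      scaled⇒agree-inner t t∈ = x∙y⁻¹≈ε⇒x≈y _ _ (ℍ*.trans (ratio≈scaling t) (scaling-inner {t} t∈))

      scaled⇒agree-tutte : (∀ e → η e ℍ*.≈ ℍ*.ε) → ∀ t → InTutte t → ⟦ Φ ⟧ t ℍ*.≈ ⟦ Ψ ⟧ t
      scaled⇒agree-tutte η≈ε t t∈ = x∙y⁻¹≈ε⇒x≈y _ _ (ℍ*.trans (ratio≈scaling t) (scaling-tutte η≈ε t∈))

    module _ {P} {P-isSubgroup : IsSubgroup 𝕋ᶜ P} (S : Splitting P-isSubgroup) where
      open Splitting S

      -- The ratio is trivial on `P`, which contains `t · σ t ⁻`, so it takes the same value at `t`
      -- and at `σ t`. The scalars are its values at the words `η`, `b` and `l`.
      agree⇒scaled : (∀ t → P t → ⟦ Φ ⟧ t ℍ*.≈ ⟦ Ψ ⟧ t) →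
                     ScaledBy (ratio.⟦_⟧ ∘ η) (ratio.⟦_⟧ ∘ b) (ratio.⟦_⟧ ∘ l)
      agree⇒scaled agree = record
        { on-circuits   = λ C x → ℍ*.trans (ratio-σ _)
            (ℍ*.trans (ratio.⟦⟧-cong (scaling-circuit C x)) (ratio.homo _ _))
        ; on-cocircuits = λ D y → ℍ*.trans (ratio-σ _) (ℍ*.trans (ratio.⟦⟧-cong (scaling-cocircuit D y))
            (ℍ*.trans (ratio.homo (η (value y) ⁻) (l D)) (ℍ*.∙-congʳ (ratio.⁻¹-homo _))))
        }
        where
        ratio-σ : ∀ t → ratio.⟦ t ⟧ ℍ*.≈ ratio.⟦ σ t ⟧
        ratio-σ t = x∙y⁻¹≈ε⇒x≈y _ _ (ℍ*.trans
          (ℍ*.sym (ℍ*.trans (ratio.homo t (σ t ⁻)) (ℍ*.∙-congˡ (ratio.⁻¹-homo (σ t)))))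
          (x≈y⇒x∙y⁻¹≈ε (agree _ (remainder∈ t))))

    -- Cocircuit signatures are values of `Φ` twisted by `τ`, so the scalars `l D` are twisted as
    -- well.
    ∼⇒scaled : signatures Φ ∼ signatures Ψ → ∃₂ λ b l → ScaledBy (λ _ → ℍ*.ε) b l
    ∼⇒scaled (b , l , γ≈ , δ≈) = b , τ* ∘ l , record
      { on-circuits   = λ C x → ℍ*.trans (scaled⇒ratio ℍ* (γ≈ C x)) (ℍ*.sym (ℍ*.identityˡ _))
      ; on-cocircuits = λ D y → ℍ*.trans (scaled⇒ratio ℍ* (τ*-transpose (δ≈ D y)))
          (ℍ*.sym (ℍ*.trans (ℍ*.∙-congʳ ε⁻¹≈ε) (ℍ*.identityˡ _)))
      }

    scaled⇒∼ : ∀ {η b l} → (∀ e → η e ℍ*.≈ ℍ*.ε) → ScaledBy η b l → signatures Φ ∼ signatures Ψ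
    scaled⇒∼ {η} {b} {l} η≈ε scaled = b , τ* ∘ l
      , (λ C x → ratio⇒scaled ℍ* (ℍ*.trans (on-circuits C x) (ℍ*.trans (ℍ*.∙-congʳ (η≈ε _)) (ℍ*.identityˡ _))))
      , (λ D y → ℍ*.trans (τ*-cong (ratio⇒scaled ℍ* (ℍ*.trans (on-cocircuits D y)
          (ℍ*.trans (ℍ*.∙-congʳ (ℍ*.trans (ℍ*.⁻¹-cong (η≈ε _)) ε⁻¹≈ε)) (ℍ*.identityˡ _))))) (τ*-∙ _ _))
      where open ScaledBy scaled

    -- The scalars of the two `∼` steps merge for each circuit and cocircuit. On cocircuits the two
    -- applications of `τ` cancel, which leaves the inverse of `η`.
    Cong⇒scaled : ∀ {s} → Cong s (signatures Φ) (signatures Ψ) → ∃ λ η → ∃₂ λ b l → ScaledBy η b l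
    Cong⇒scaled (_ , _ , _ , _ , (b , l , γ≈ , δ≈) , (η , γ≈′ , δ≈′) , (b′ , l′ , γ≈″ , δ≈″)) =
      η , (λ C → b C ℍ*.∙ b′ C) , (λ D → τ* (l D ℍ*.∙ l′ D)) , record
      { on-circuits   = λ C x → scaled⇒ratio ℍ* (ℍ*.trans
          (ℍ*.trans (γ≈ C x) (ℍ*.∙-congˡ (ℍ*.trans (γ≈′ C x) (ℍ*.∙-congˡ (γ≈″ C x)))))
          (regroup ℍ* _ _ _ _))
      ; on-cocircuits = λ D y → ℍ*.trans
          (scaled⇒ratio ℍ* (τ*-transpose (ℍ*.trans
            (ℍ*.trans (δ≈ D y) (ℍ*.∙-congˡ (ℍ*.trans (δ≈′ D y) (ℍ*.∙-congˡ (δ≈″ D y)))))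
            (regroup ℍ* _ _ _ _))))
          (ℍ*.trans (τ*-∙ _ _) (ℍ*.∙-congʳ (τ*-involutive _)))
      }

    -- Rescaling the signatures of `Ψ` by `η` gives the intermediate representative; it differs from
    -- those of `Φ` only by `b` and `l` and inherits their orthogonality.
    scaled⇒Cong : ∀ s {η b l} → Orthogonal s (signatures Φ) → Orthogonal s (signatures Ψ) →
                  ScaledBy η b l → Cong s (signatures Φ) (signatures Ψ)
    scaled⇒Cong s {η} {b} {l} Φ⊥ Ψ⊥ scaled =
      rescaled , signatures Ψ , orthogonal-∼ s (∼-sym Φ∼) Φ⊥ , Ψ⊥ , Φ∼
      , (η , (λ _ _ → ℍ*.refl) , (λ _ _ → ℍ*.refl)) , ∼-refl
      where
      open ScaledBy scaled
      rescaled : Signatures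
      rescaled = (λ C x → η (value x) ℍ*.∙ γ (signatures Ψ) C x)
               , (λ D y → τ* (η (value y) ℍ*.⁻¹) ℍ*.∙ δ (signatures Ψ) D y)
      Φ∼ : signatures Φ ∼ rescaled
      Φ∼ = b , τ* ∘ l
         , (λ C x → ℍ*.trans (ratio⇒scaled ℍ* (on-circuits C x)) (xy∙z≈y∙xz _ _ _))
         , (λ D y → ℍ*.trans (τ*-cong (ℍ*.trans (ratio⇒scaled ℍ* (on-cocircuits D y)) (xy∙z≈y∙xz _ _ _)))
             (ℍ*.trans (τ*-∙ _ _) (ℍ*.∙-congˡ (τ*-∙ _ _))))

    ∼⇔agree-tutte : signatures Φ ∼ signatures Ψ ⇔ (∀ t → InTutte t → ⟦ Φ ⟧ t ℍ*.≈ ⟦ Ψ ⟧ t)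
    ∼⇔agree-tutte = mk⇔
      (λ Φ∼Ψ → let _ , _ , scaled = ∼⇒scaled Φ∼Ψ in scaled⇒agree-tutte scaled λ _ → ℍ*.refl)
      (λ agree → scaled⇒∼ (λ _ → ratio.ε-homo) (agree⇒scaled tutteSplitting agree))

    Cong⇔agree-inner : ∀ s → Condition Φ s → Condition Ψ s →
      Cong s (signatures Φ) (signatures Ψ) ⇔ (∀ t → InInner t → ⟦ Φ ⟧ t ℍ*.≈ ⟦ Ψ ⟧ t)
    Cong⇔agree-inner s condΦ condΨ = mk⇔
      (λ Φ≅Ψ → let _ , _ , _ , scaled = Cong⇒scaled Φ≅Ψ in scaled⇒agree-inner scaled)
      (λ agree → scaled⇒Cong s (condition⇒orthogonal s Φ condΦ) (condition⇒orthogonal s Ψ condΨ)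
        (agree⇒scaled innerSplitting agree))

  -- Extension of homomorphisms from the two subgroups.

  module _ {P} {P-isSubgroup : IsSubgroup 𝕋ᶜ P} (S : Splitting P-isSubgroup)
           (Φ₀ : Hom (subgroup 𝕋ᶜ P-isSubgroup) ℍ*) where
    open Splitting S
    private
      module Φ₀ = GroupHomomorphism Φ₀
      module ρ = GroupHomomorphism (quotient 𝕋ᶜ 𝕋ᶜ (identityHom 𝕋ᶜ) scaling)

    extension : Hom 𝕋ᶜ ℍ*
    extension = ∙-homo⇒homomorphism ℍ* 𝕋ᶜ (λ t → Φ₀.⟦ t · σ t ⁻ , remainder∈ t ⟧)
      (λ s≈t → Φ₀.⟦⟧-cong (ρ.⟦⟧-cong s≈t))
      (λ s t → ℍ*.trans (Φ₀.⟦⟧-cong (ρ.homo s t)) (Φ₀.homo _ _))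

    extension-restricts : ∀ t (t∈ : P t) → GroupHomomorphism.⟦_⟧ extension t ℍ*.≈ Φ₀.⟦ t , t∈ ⟧
    extension-restricts t t∈ = Φ₀.⟦⟧-cong (𝕋ᶜ.trans
      (𝕋ᶜ.∙-congˡ (𝕋ᶜ.trans (𝕋ᶜ.⁻¹-cong (σ-trivial t∈)) (AbelianGroupProperties.ε⁻¹≈ε 𝕋ᶜ))) (𝕋ᶜ.identityʳ t))

  extendTutte : TutteHomomorphism tutteGroup → TutteHomomorphism extendedTutteGroup
  extendTutte Ψ = record
    { homomorphism = extension tutteSplitting Ψ.homomorphism
    ; εᴹ-homo      = ℍ*.trans (extension-restricts tutteSplitting Ψ.homomorphism ε₀ (gen ε-gen)) Ψ.εᴹ-homo
    }
    where module Ψ = TutteHomomorphism Ψ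

  restrict-extendTutte : ∀ Ψ → restrictTutte (extendTutte Ψ) ≗ᴴ Ψ
  restrict-extendTutte Ψ (t , t∈) = extension-restricts tutteSplitting (TutteHomomorphism.homomorphism Ψ) t t∈

  extendInner : TutteHomomorphism innerTutteGroup → TutteHomomorphism extendedTutteGroup
  extendInner Ψ = record
    { homomorphism = extension innerSplitting Ψ.homomorphism
    ; εᴹ-homo      = ℍ*.trans (extension-restricts innerSplitting Ψ.homomorphism ε₀ _) Ψ.εᴹ-homo
    }
    where module Ψ = TutteHomomorphism Ψ

  restrict-extendInner : ∀ Ψ → restrictInner (extendInner Ψ) ≗ᴴ Ψ
  restrict-extendInner Ψ (t , t∈) = extension-restricts innerSplitting (TutteHomomorphism.homomorphism Ψ) t t∈

  -- The conditions only involve values at cross ratios, which exist in all three groups, so they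
  -- pass along restriction and extension.
  condition-resp : ∀ s {T T′} (Φ : TutteHomomorphism T) (Ψ : TutteHomomorphism T′) →
    (∀ C C′ x y → ⟦ Φ ⟧ (CrossRatioGroup.crossRatio T C C′ x y)
         ℍ*.≈ ⟦ Ψ ⟧ (CrossRatioGroup.crossRatio T′ C C′ x y)) →
    Condition Φ s → Condition Ψ s
  condition-resp strong Φ Ψ Φ≈Ψ cond k 2≤k C D x enum C′ C′∩D =
    ⊞∑-tabulate-cong (λ j → ≈*⇒≈ (Φ≈Ψ C (C′ j) _ _)) (cond k 2≤k C D x enum C′ C′∩D)
  condition-resp weak Φ Ψ Φ≈Ψ cond k 2≤k k≤2 C D x enum C′ C′∩D =
    ⊞∑-tabulate-cong (λ j → ≈*⇒≈ (Φ≈Ψ C (C′ j) _ _)) (cond k 2≤k k≤2 C D x enum C′ C′∩D)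

  -- The one-to-one correspondences.

  module _ (s : Strength) where
    private
      Φ[_] : ∃ (Orthogonal s) → TutteHomomorphism extendedTutteGroup
      Φ[ p , p⊥ ] = FromSignatures.hom s p p⊥

      Φ[]-condition : ∀ p → Condition Φ[ p ] s
      Φ[]-condition (p , p⊥) = FromSignatures.condition s p p⊥

      signatures-Φ[] : ∀ p → signatures Φ[ p ] ≈ˢ proj₁ p
      signatures-Φ[] (p , p⊥) = FromSignatures.signatures-hom s p p⊥

      signatures-Φ[]-∼ : ∀ p → signatures Φ[ p ] ∼ proj₁ p
      signatures-Φ[]-∼ p = ≈ˢ⇒∼ (signatures-Φ[] p)

    uniqueHom : ∀ p → Orthogonal s p → ∃! _≗ᴴ_ λ (Φ : TutteHomomorphism extendedTutteGroup) →
        Condition Φ s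
      × (∀ C x → ⟦ Φ ⟧ (C ⟨ x ⟩) ℍ*.≈ γ p C x)
      × (∀ D y → ⟦ Φ ⟧ (D ⟨ y ⟩*) ℍ*.≈ τ* (δ p D y))
    uniqueHom p p⊥ = hom , (condition , (λ _ _ → ℍ*.refl) , (λ _ _ → ℍ*.refl)) ,
      λ {Ψ} (_ , γ≈ , δ≈) → homs-agree hom Ψ
        ((λ C x → ℍ*.sym (γ≈ C x)) , (λ D y → τ*-cong (ℍ*.sym (δ≈ D y))))
      where open FromSignatures s p p⊥

    -- Injectivity is the hypothesis relating `≈ᶜ` to agreement after restriction; surjectivity
    -- holds because every homomorphism on the smaller group extends.
    inducedBijection : ∀ {T r} {_≈ᶜ_ : Rel (∃ (Orthogonal s)) r} (≈ᶜ-isEquivalence : IsEquivalence _≈ᶜ_)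
      (restrict : TutteHomomorphism extendedTutteGroup → TutteHomomorphism T)
      (extend : TutteHomomorphism T → TutteHomomorphism extendedTutteGroup) →
      (∀ Φ Ψ → Φ ≗ᴴ Ψ → restrict Φ ≗ᴴ restrict Ψ) →
      (∀ Φ C C′ x y → ⟦ restrict Φ ⟧ (CrossRatioGroup.crossRatio T C C′ x y)
                     ℍ*.≈ ⟦ Φ ⟧ (crossRatioᶜ C C′ x y)) →
      (∀ Ψ → restrict (extend Ψ) ≗ᴴ Ψ) →
      (∀ p q → p ≈ᶜ q ⇔ restrict Φ[ p ] ≗ᴴ restrict Φ[ q ]) →
      ∃ λ (f : Bijection (record { isEquivalence = ≈ᶜ-isEquivalence }) (Homs s T)) →
        ∀ Φ (⊥Φ : Orthogonal s (signatures Φ)) →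
          proj₁ (Bijection.to f (signatures Φ , ⊥Φ)) ≗ᴴ restrict Φ
    inducedBijection {T} ≈ᶜ-isEquivalence restrict extend restrict-cong restrict-crossRatio restrict-extend ≈⇔ =
      record
        { to        = λ p → restrict Φ[ p ]
            , condition-resp s Φ[ p ] (restrict Φ[ p ])
                (λ C C′ x y → ℍ*.sym (restrict-crossRatio Φ[ p ] C C′ x y)) (Φ[]-condition p)
        ; cong      = λ {p} {q} → to (≈⇔ p q)
        ; bijective = (λ {p} {q} → from (≈⇔ p q))
                    -- The preimage of `Ψ` consists of the signatures of its extension; everything
                    -- equivalent to it must also be mapped to `Ψ`.
                    , λ (Ψ , cond) → (signatures (extend Ψ) , orthogonal Ψ cond) , λ {p} p≈ t → ℍ*.trans
                        (to (≈⇔ p (signatures (extend Ψ) , orthogonal Ψ cond)) p≈ t)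
                        (ℍ*.trans (induced (extend Ψ) (orthogonal Ψ cond) t) (restrict-extend Ψ t))
        }
      , induced
      where
      open Function.Equivalence
      induced : ∀ Φ (⊥Φ : Orthogonal s (signatures Φ)) → restrict Φ[ signatures Φ , ⊥Φ ] ≗ᴴ restrict Φ
      induced Φ ⊥Φ = restrict-cong Φ[ signatures Φ , ⊥Φ ] Φ
        (homs-agree Φ[ signatures Φ , ⊥Φ ] Φ (signatures-Φ[] (signatures Φ , ⊥Φ)))
      orthogonal : ∀ Ψ → Condition Ψ s → Orthogonal s (signatures (extend Ψ))
      orthogonal Ψ cond = condition⇒orthogonal s (extend Ψ) (condition-resp s Ψ (extend Ψ)
        (λ C C′ x y → ℍ*.trans (ℍ*.sym (restrict-extend Ψ (CrossRatioGroup.crossRatio T C C′ x y)))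
                               (restrict-crossRatio (extend Ψ) C C′ x y)) cond)

    ≈ˢ⇔agree : ∀ p q → proj₁ p ≈ˢ proj₁ q ⇔ Φ[ p ] ≗ᴴ Φ[ q ]
    ≈ˢ⇔agree p q = mk⇔
      (λ (γ≈ , δ≈) → homs-agree Φ[ p ] Φ[ q ] (γ≈ , λ D y → τ*-cong (τ*-cong (δ≈ D y))))
      (λ Φp≗Φq → (λ C x → Φp≗Φq (C ⟨ x ⟩)) , (λ D y → τ*-injective (Φp≗Φq (D ⟨ y ⟩*))))

    -- As `τ` is involutive only up to `≈`, the signatures of `Φ[ p ]` match `p` only up to `≈ˢ`, so
    -- the criterion is transported along `∼`.
    ∼⇔agree : ∀ p q → proj₁ p ∼ proj₁ q ⇔ restrictTutte Φ[ p ] ≗ᴴ restrictTutte Φ[ q ]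
    ∼⇔agree p q = mk⇔
      (λ p∼q (t , t∈) → to equiv (∼-trans (signatures-Φ[]-∼ p) (∼-trans p∼q (∼-sym (signatures-Φ[]-∼ q)))) t t∈)
      (λ Φp≗Φq → ∼-trans (∼-sym (signatures-Φ[]-∼ p))
        (∼-trans (from equiv λ t t∈ → Φp≗Φq (t , t∈)) (signatures-Φ[]-∼ q)))
      where
      open Function.Equivalence
      equiv = ∼⇔agree-tutte Φ[ p ] Φ[ q ]

    Cong⇔agree : ∀ p q → Cong s (proj₁ p) (proj₁ q) ⇔ restrictInner Φ[ p ] ≗ᴴ restrictInner Φ[ q ]
    Cong⇔agree p q = mk⇔
      (λ p≅q (t , t∈) → to equiv (shift (signatures-Φ[]-∼ p) p≅q (∼-sym (signatures-Φ[]-∼ q))) t t∈)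
      (λ Φp≗Φq → shift (∼-sym (signatures-Φ[]-∼ p)) (from equiv λ t t∈ → Φp≗Φq (t , t∈)) (signatures-Φ[]-∼ q))
      where
      open Function.Equivalence
      equiv = Cong⇔agree-inner Φ[ p ] Φ[ q ] s (Φ[]-condition p) (Φ[]-condition q)
      shift : ∀ {p p′ q q′} → p ∼ p′ → Cong s p′ q′ → q′ ∼ q → Cong s p q
      shift p∼p′ (p″ , q″ , p″⊥ , q″⊥ , p′∼p″ , p″≈q″ , q″∼q′) q′∼q =
        p″ , q″ , p″⊥ , q″⊥ , ∼-trans p∼p′ p′∼p″ , p″≈q″ , ∼-trans q″∼q′ q′∼q

theorem4p1 :
  ∀ {n : ℕ} (M : Matroid n) {c ℓ h} (ℍ : Hyperfield c ℓ h) (involution : Involution ℍ) →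
  let open Tutte M
      open Involution involution using (τ*)
      open HyperfieldMatroids M ℍ involution
  in
  -- (5): everything holds in the strong case, and in the weak case
  ∀ (s : Strength) →
  -- (1)
    (∀ (p : Signatures) → Orthogonal s p →
      ∃! _≗ᴴ_ λ (Φ : TutteHomomorphism extendedTutteGroup) →
          Condition Φ s
        × (∀ C x → ⟦ Φ ⟧ (C ⟨ x ⟩) ℍ*.≈ γ p C x)
        × (∀ D y → ⟦ Φ ⟧ (D ⟨ y ⟩*) ℍ*.≈ τ* (δ p D y)))
  -- (2)
  × (∀ (Φ : TutteHomomorphism extendedTutteGroup) → Condition Φ s →
      Orthogonal s (signatures Φ))
  -- (3)
  × (∀ (Φ Ψ : TutteHomomorphism extendedTutteGroup) → Condition Φ s → Condition Ψ s →
        (signatures Φ ∼ signatures Ψ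
          ⇔ (∀ t → InTutte t → ⟦ Φ ⟧ t ℍ*.≈ ⟦ Ψ ⟧ t))
      × (Cong s (signatures Φ) (signatures Ψ)
          ⇔ (∀ t → InInner t → ⟦ Φ ⟧ t ℍ*.≈ ⟦ Ψ ⟧ t)))
  -- (4): the correspondences are those induced by Φ ↦ signatures Φ
  × (∃ λ (f : Bijection (𝓝 s) (Homs s extendedTutteGroup)) →
      ∀ Φ (⊥Φ : Orthogonal s (signatures Φ)) →
        proj₁ (Bijection.to f (signatures Φ , ⊥Φ)) ≗ᴴ Φ)
  × (∃ λ (f : Bijection (𝓜 s) (Homs s tutteGroup)) →
      ∀ Φ (⊥Φ : Orthogonal s (signatures Φ)) →
        proj₁ (Bijection.to f (signatures Φ , ⊥Φ)) ≗ᴴ restrictTutte Φ)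
  × (∃ λ (f : Bijection (𝓡 s) (Homs s innerTutteGroup)) →
      ∀ Φ (⊥Φ : Orthogonal s (signatures Φ)) →
        proj₁ (Bijection.to f (signatures Φ , ⊥Φ)) ≗ᴴ restrictInner Φ)
theorem4p1 M ℍ involution s =
    uniqueHom s
  , condition⇒orthogonal s
  , (λ Φ Ψ condΦ condΨ → ∼⇔agree-tutte Φ Ψ , Cong⇔agree-inner Φ Ψ s condΦ condΨ)
  , inducedBijection s (Setoid.isEquivalence (𝓝 s)) id id (λ _ _ Φ≗Ψ → Φ≗Ψ)
      (λ _ _ _ _ _ → ℍ*.refl) (λ _ _ → ℍ*.refl) (≈ˢ⇔agree s)
  , inducedBijection s (Setoid.isEquivalence (𝓜 s)) restrictTutte extendTutte (λ _ _ Φ≗Ψ (t , _) → Φ≗Ψ t)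
      (λ _ _ _ _ _ → ℍ*.refl) restrict-extendTutte (∼⇔agree s)
  , inducedBijection s (Setoid.isEquivalence (𝓡 s)) restrictInner extendInner (λ _ _ Φ≗Ψ (t , _) → Φ≗Ψ t)
      (λ _ _ _ _ _ → ℍ*.refl) restrict-extendInner (Cong⇔agree s)
  where
  open Correspondence M ℍ involution
  open HyperfieldMatroids M ℍ involution
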